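{- Over any field of characteristic different from 2, the family $(f_k)$ with $f_k=f_{G_k,H_k}(\bar Y)$, where $G_k$ is the simple undirected cycle of length $2k+1$ and $H_k$ is the undirected complete graph on $(2k+1)^2$ vertices, is complete for $\mathsf{VBP}$ under $p$-projections.
   Context: For graphs $G,H$, a homomorphism $G\to H$ is a vertex map preserving edges. With a variable $Y_{(a,b)}$ for each edge $(a,b)\in E(H)$, the homomorphism polynomial is $f_{G,H}(\bar Y)=\sum_{\phi}\prod_{(u,v)\in E(G)}Y_{(\phi(u),\phi(v))}$, the sum over all homomorphisms $\phi:G\to H$. $\mathsf{VBP}$ is the class of $p$-families (polynomially bounded number of variables and degree) computed by polynomial-size skew arithmetic circuits (at each $\times$ gate at most one input is the output of another gate). A projection of $g$ substitutes field constants or variables for the variables of $g$; $(f_n)$ is a $p$-projection of $(g_m)$ if each $f_n$ is a projection of $g_{t(n)}$ with $t$ polynomially bounded. Complete for $\mathsf{VBP}$ under $p$-projections means the family is in $\mathsf{VBP}$ and every family in $\mathsf{VBP}$ is a $p$-projection of it. -}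

module Defs where

open import Level using (Level; 0ℓ; _⊔_)
open import Algebra.Apartness.Bundles using (HeytingField)
open import Data.Empty using (⊥-elim)
open import Data.Fin.Base using (Fin; zero; suc; toℕ; finToFun; _<_)
open import Data.Fin.Properties using (_≟_; _<?_; all?; <-cmp)
open import Data.List.Base
  using (List; []; _∷_; length; lookup; filter; cartesianProduct; allFin; foldr; map; mapMaybe)
open import Data.List.Membership.Propositional using (_∈_)
open import Data.List.Membership.Propositional.Properties
  using (∈-filter⁺; ∈-filter⁻; ∈-cartesianProduct⁺; ∈-allFin; ∈-lookup)
open import Data.List.Relation.Unary.All using (All)
open import Data.List.Relation.Unary.Any using (index)
open import Data.Maybe.Base as Maybe using ()
open import Data.Nat.Base as ℕ using (ℕ; zero; suc; NonZero)
open import Data.Nat.DivMod using (_%_)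
import Data.Nat.Properties as ℕ
open import Data.Product.Base using (Σ; ∃-syntax; _×_; _,_; proj₁; proj₂)
open import Data.Sum.Base using (_⊎_; inj₁; inj₂; swap)
open import Relation.Binary.Core using (Rel)
open import Relation.Binary.Definitions using (Decidable; tri<; tri≈; tri>)
open import Relation.Binary.PropositionalEquality.Core using (_≡_; _≢_; refl; ≢-sym)
open import Relation.Nullary.Decidable.Core
  using (Dec; ¬?; dec⇒maybe; _×-dec_; _⊎-dec_; _→-dec_)
open import Relation.Nullary.Negation.Core using (¬_)

record Graph : Set₁ where
  infix 4 _~_ _~?_
  field
    order    : ℕ
    _~_      : Rel (Fin order) 0ℓ
    _~?_     : Decidable _~_
    ~-sym    : ∀ {u v} → u ~ v → v ~ u
    ~-irrefl : ∀ {u} → ¬ (u ~ u)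

  Vertex : Set
  Vertex = Fin order

  IsEdge : Vertex × Vertex → Set
  IsEdge (u , v) = u < v × u ~ v

  isEdge? : ∀ e → Dec (IsEdge e)
  isEdge? (u , v) = (u <? v) ×-dec (u ~? v)

  -- Every undirected edge occurs exactly once, with its smaller endpoint first.
  edges : List (Vertex × Vertex)
  edges = filter isEdge? (cartesianProduct (allFin order) (allFin order))

  Edge : Set
  Edge = Fin (length edges)

  src tgt : Edge → Vertex
  src e = proj₁ (lookup edges e)
  tgt e = proj₂ (lookup edges e)

  adjacent : (e : Edge) → src e ~ tgt e
  adjacent e = proj₂ (proj₂ (∈-filter⁻ isEdge?
    {xs = cartesianProduct (allFin order) (allFin order)} (∈-lookup e)))

  listed : ∀ {u v} → u < v → u ~ v → (u , v) ∈ edges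
  listed u<v u~v =
    ∈-filter⁺ isEdge? (∈-cartesianProduct⁺ (∈-allFin _) (∈-allFin _)) (u<v , u~v)

  -- The undirected edge {u , v}, so that edge {u} {v} and edge {v} {u} agree.
  edge : ∀ {u v} → u ~ v → Edge
  edge {u} {v} u~v with <-cmp u v
  ... | tri< u<v _ _    = index (listed u<v u~v)
  ... | tri≈ _ refl _   = ⊥-elim (~-irrefl u~v)
  ... | tri> _ _ v<u    = index (listed v<u (~-sym u~v))

complete : ℕ → Graph
complete n = record
  { order    = n
  ; _~_      = _≢_
  ; _~?_     = λ u v → ¬? (u ≟ v)
  ; ~-sym    = ≢-sym
  ; ~-irrefl = λ u≢u → u≢u refl
  }

-- The condition u ≢ v only matters for n = 1, where it discards the loop that
-- a simple graph may not have; for n ≥ 3 this is the usual n-cycle.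
cycle : (n : ℕ) .{{_ : NonZero n}} → Graph
cycle n = record
  { order    = n
  ; _~_      = λ u v → u ≢ v × (Next u v ⊎ Next v u)
  ; _~?_     = λ u v → ¬? (u ≟ v) ×-dec (next? u v ⊎-dec next? v u)
  ; ~-sym    = λ (u≢v , a) → ≢-sym u≢v , swap a
  ; ~-irrefl = λ (u≢u , _) → u≢u refl
  }
  where
  Next : Rel (Fin n) 0ℓ
  Next u v = suc (toℕ u) % n ≡ toℕ v

  next? : Decidable Next
  next? u v = suc (toℕ u) % n ℕ.≟ toℕ v

module _ (G H : Graph) where
  private
    module G = Graph G
    module H = Graph H

  IsHom : (G.Vertex → H.Vertex) → Set
  IsHom φ = ∀ u v → u G.~ v → φ u H.~ φ v

  isHom? : ∀ φ → Dec (IsHom φ)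
  isHom? φ = all? λ u → all? λ v → (u G.~? v) →-dec (φ u H.~? φ v)

  Hom : Set
  Hom = Σ (G.Vertex → H.Vertex) IsHom

  -- finToFun is a bijection (up to pointwise equality) from Fin (m ^ n) to the
  -- maps Fin n → Fin m, so every homomorphism is listed exactly once.
  homs : List Hom
  homs = mapMaybe (λ i → let φ = finToFun i in Maybe.map (φ ,_) (dec⇒maybe (isHom? φ)))
                  (allFin (H.order ℕ.^ G.order))

PolyBounded : (ℕ → ℕ) → Set
PolyBounded t = ∃[ c ] ∀ n → t n ℕ.≤ n ℕ.^ c ℕ.+ c

module _ {c ℓ₁ ℓ₂ : Level} (F : HeytingField c ℓ₁ ℓ₂) where
  private module F = HeytingField F

  -- Different from 2 in the sense of the apartness; for decidable ≈ and # this is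
  -- the negation of 1 + 1 ≈ 0.
  Characteristic≢2 : Set ℓ₂
  Characteristic≢2 = (F.1# F.+ F.1#) F.# F.0#

  infixl 6 _⊕_
  infixl 7 _⊗_

  -- The polynomial ring F[X] is the setoid of expressions below under _≋_, the
  -- least congruence making it a commutative F-algebra (the free one on X).
  -- Negatives need no clause: con (- 1#) ⊗ p is additively inverse to p.
  data Poly (X : Set) : Set c where
    con     : F.Carrier → Poly X
    var     : X → Poly X
    _⊕_ _⊗_ : Poly X → Poly X → Poly X

  infix 4 _≋_

  data _≋_ {X : Set} : Poly X → Poly X → Set (c ⊔ ℓ₁) where
    ≋-refl  : ∀ {p} → p ≋ p
    ≋-sym   : ∀ {p q} → p ≋ q → q ≋ p
    ≋-trans : ∀ {p q r} → p ≋ q → q ≋ r → p ≋ r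

    ⊕-cong  : ∀ {p p′ q q′} → p ≋ p′ → q ≋ q′ → p ⊕ q ≋ p′ ⊕ q′
    ⊗-cong  : ∀ {p p′ q q′} → p ≋ p′ → q ≋ q′ → p ⊗ q ≋ p′ ⊗ q′

    ⊕-assoc     : ∀ p q r → (p ⊕ q) ⊕ r ≋ p ⊕ (q ⊕ r)
    ⊕-comm      : ∀ p q → p ⊕ q ≋ q ⊕ p
    ⊕-identityˡ : ∀ p → con F.0# ⊕ p ≋ p
    ⊗-assoc     : ∀ p q r → (p ⊗ q) ⊗ r ≋ p ⊗ (q ⊗ r)
    ⊗-comm      : ∀ p q → p ⊗ q ≋ q ⊗ p
    ⊗-identityˡ : ∀ p → con F.1# ⊗ p ≋ p
    ⊗-distribˡ  : ∀ p q r → p ⊗ (q ⊕ r) ≋ (p ⊗ q) ⊕ (p ⊗ r)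
    ⊗-zeroˡ     : ∀ p → con F.0# ⊗ p ≋ con F.0#

    con-cong : ∀ {a b} → a F.≈ b → con a ≋ con b
    con-+    : ∀ a b → con (a F.+ b) ≋ con a ⊕ con b
    con-*    : ∀ a b → con (a F.* b) ≋ con a ⊗ con b

  ∑ ∏ : ∀ {X} → List (Poly X) → Poly X
  ∑ = foldr _⊕_ (con F.0#)
  ∏ = foldr _⊗_ (con F.1#)

  -- A monomial is the list of its variables, repeated according to multiplicity.
  DegreeAtMost : ∀ {X} → ℕ → Poly X → Set (c ⊔ ℓ₁)
  DegreeAtMost {X} d p =
    Σ (List (F.Carrier × List X)) λ terms →
      All (λ (_ , m) → length m ℕ.≤ d) terms ×
      p ≋ ∑ (map (λ (a , m) → con a ⊗ ∏ (map var m)) terms)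

  -- Field constants or variables: the inputs of circuits, and what a projection
  -- may substitute.
  data Atom (X : Set) : Set c where
    const : F.Carrier → Atom X
    indet : X → Atom X

  ⟦_⟧ᵃ : ∀ {X} → Atom X → Poly X
  ⟦ const a ⟧ᵃ = con a
  ⟦ indet x ⟧ᵃ = var x

  data Operand (X : Set) (s : ℕ) : Set c where
    input : Atom X → Operand X s
    gate  : Fin s → Operand X s

  data Gate (X : Set) (s : ℕ) : Set c where
    add mul : Operand X s → Operand X s → Gate X s

  infixl 5 _▷_

  -- The index is the size, that is the number of gates.  A gate refers to
  -- earlier gates by counting backwards: gate zero is the one just before it.
  data Circuit (X : Set) : ℕ → Set c where
    []  : Circuit X 0
    _▷_ : ∀ {s} → Circuit X s → Gate X s → Circuit X (suc s)

  module _ {X : Set} where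

    ⟦_⟧ᵒ : ∀ {s} → Operand X s → (Fin s → Poly X) → Poly X
    ⟦ input a ⟧ᵒ ρ = ⟦ a ⟧ᵃ
    ⟦ gate i ⟧ᵒ  ρ = ρ i

    ⟦_⟧ᵍ : ∀ {s} → Gate X s → (Fin s → Poly X) → Poly X
    ⟦ add x y ⟧ᵍ ρ = ⟦ x ⟧ᵒ ρ ⊕ ⟦ y ⟧ᵒ ρ
    ⟦ mul x y ⟧ᵍ ρ = ⟦ x ⟧ᵒ ρ ⊗ ⟦ y ⟧ᵒ ρ

    ⟦_⟧ : ∀ {s} → Circuit X s → Fin s → Poly X
    ⟦ C ▷ g ⟧ zero    = ⟦ g ⟧ᵍ ⟦ C ⟧
    ⟦ C ▷ g ⟧ (suc i) = ⟦ C ⟧ i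

    data IsInput {s} : Operand X s → Set c where
      input : ∀ a → IsInput (input a)

    data SkewGate {s} : Gate X s → Set c where
      add : ∀ x y → SkewGate (add x y)
      mul : ∀ {x y} → IsInput x ⊎ IsInput y → SkewGate (mul x y)

    data Skew : ∀ {s} → Circuit X s → Set c where
      []  : Skew []
      _▷_ : ∀ {s} {C : Circuit X s} {g} → Skew C → SkewGate g → Skew (C ▷ g)

    record SkewCircuitFor (p : Poly X) (s : ℕ) : Set (c ⊔ ℓ₁) where
      field
        circuit  : Circuit X s
        skew     : Skew circuit
        output   : Operand X s
        computes : ⟦ output ⟧ᵒ ⟦ circuit ⟧ ≋ p

  record Family : Set c where
    field
      numVars : ℕ → ℕ
      poly    : ∀ n → Poly (Fin (numVars n))

  open Family

  record IsPFamily (f : Family) : Set (c ⊔ ℓ₁) where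
    field
      numVars-bounded : PolyBounded (numVars f)
      degree          : ℕ → ℕ
      degree-bounded  : PolyBounded degree
      hasDegree       : ∀ n → DegreeAtMost (degree n) (poly f n)

  record VBP (f : Family) : Set (c ⊔ ℓ₁) where
    field
      isPFamily    : IsPFamily f
      size         : ℕ → ℕ
      size-bounded : PolyBounded size
      circuits     : ∀ n → SkewCircuitFor (poly f n) (size n)

  substitute : ∀ {X Y} → (Y → Atom X) → Poly Y → Poly X
  substitute σ (con a) = con a
  substitute σ (var y) = ⟦ σ y ⟧ᵃ
  substitute σ (p ⊕ q) = substitute σ p ⊕ substitute σ q
  substitute σ (p ⊗ q) = substitute σ p ⊗ substitute σ q

  IsProjection : ∀ {X Y} → Poly X → Poly Y → Set (c ⊔ ℓ₁)
  IsProjection {X} {Y} p q = Σ (Y → Atom X) λ σ → p ≋ substitute σ q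

  IsPProjection : Family → Family → Set (c ⊔ ℓ₁)
  IsPProjection f g =
    Σ (ℕ → ℕ) λ t → PolyBounded t × (∀ n → IsProjection (poly f n) (poly g (t n)))

  VBPComplete : Family → Set (c ⊔ ℓ₁)
  VBPComplete g = VBP g × (∀ f → VBP f → IsPProjection f g)

  -- One variable per undirected edge of H, so Y_(a,b) and Y_(b,a) coincide, and
  -- the product runs once over each undirected edge of G.
  homPoly : (G H : Graph) → Poly (Graph.Edge H)
  homPoly G H = ∑ (map monomial (homs G H))
    where
    module G = Graph G
    module H = Graph H

    monomial : Hom G H → Poly H.Edge
    monomial (φ , φ-hom) =
      ∏ (map (λ e → var (H.edge (φ-hom (G.src e) (G.tgt e) (G.adjacent e))))
             (allFin (length G.edges)))

  homFamily : (G H : ℕ → Graph) → Family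
  homFamily G H = record
    { numVars = λ k → length (Graph.edges (H k))
    ; poly    = λ k → homPoly (G k) (H k)
    }

{-# OPTIONS --safe #-}

-- For k ≥ 1, f_k is the trace of the m-th power (m = 2k + 1) of the symmetric matrix
-- of edge variables, with zero diagonal; iterated matrix multiplication by
-- atoms is a skew circuit, so f ∈ VBP.
--
-- For hardness, a skew circuit is turned into a product M₀ ⋯ M₍ₘ₋₁₎ of m matrices of
-- atoms with trace p / 2m.  These are laid around a cycle of m layers of m vertices,
-- M_c weighting the edges from layer c to layer c + 1.  A closed walk of odd length m
-- in the underlying undirected graph has to wind around the cycle, hence always steps
-- forwards or always backwards; starting in any of the m layers this gives
-- 2m · tr(M₀ ⋯ M₍ₘ₋₁₎) = p.  The factor 2m must be invertible: the difference of the odd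
-- numbers m and m + 2 is 2 ≠ 0, so one of the two can be used.
module Submission where

open import Defs
open import Level using (Level; _⊔_)
open import Algebra.Apartness.Bundles using (HeytingCommutativeRing; HeytingField)
open import Algebra.Bundles using (CommutativeRing; CommutativeSemiring)
open import Algebra.Structures.Biased using (isCommutativeMonoidˡ; isCommutativeSemiringˡ)
open import Data.Nat.Base as ℕ using (ℕ; zero; suc; NonZero; z≤n; s≤s)
open import Data.Nat.Coprimality using (Coprime; coprime-divisor)
open import Data.Nat.Divisibility using (_∣_; ∣m+n∣m⇒∣n; n∣m*n; m∣m*n; ∣-trans; ∣1⇒≡1; ∣⇒≤)
open import Data.Nat.DivMod
  using (_%_; _/_; m≡m%n+[m/n]*n; %-distribˡ-+; m%n%n≡m%n; m<n⇒m%n≡m; m%n<n; n%n≡0; [m+n]%n≡m%n)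
import Data.Nat.Properties as ℕ
open import Data.Nat.Solver using (module +-*-Solver)
open import Data.Nat.Tactic.RingSolver using (solve-∀)
open import Data.Fin.Base as Fin
  using (Fin; zero; suc; toℕ; fromℕ; fromℕ<; inject₁; _↑ˡ_; _↑ʳ_; combine; remQuot; quotient; remainder;
         finToFun)
import Data.Fin.Properties as Fin
open import Data.List.Base as List
  using (List; []; _∷_; _++_; map; mapMaybe; allFin; tabulate; lookup; length; cartesianProduct; foldl;
         replicate)
open import Data.List.Properties
  using (map-tabulate; tabulate-lookup; map-∘; foldl-++; length-map; length-filter; length-tabulate; length-++;
         length-replicate)
open import Data.List.Membership.Propositional using (_∈_)
open import Data.List.Membership.Propositional.Properties using (∈-filter⁻; ∈-map⁺; ∈-map⁻; ∈-allFin)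
open import Data.List.Membership.Propositional.Properties.WithK using (unique∧set⇒bag)
open import Data.List.Relation.Binary.BagAndSetEquality using (∼bag⇒↭)
open import Data.List.Relation.Binary.Permutation.Propositional as Perm using (_↭_)
open import Data.List.Relation.Unary.All as All using (All; []; _∷_)
import Data.List.Relation.Unary.All.Properties as All
open import Data.List.Relation.Unary.AllPairs using (_∷_)
open import Data.List.Relation.Unary.Any as Any using (Any; here; there; index)
open import Data.List.Relation.Unary.Any.Properties using (lookup-index)
open import Data.List.Relation.Unary.Unique.Propositional using (Unique)
import Data.List.Relation.Unary.Unique.Propositional.Properties as Unique
open import Data.Maybe.Base as Maybe using (Maybe; just; nothing; maybe)
open import Data.Product.Base using (∃-syntax; _×_; _,_; proj₁; proj₂)
open import Data.Product.Properties using (,-injectiveˡ; ,-injectiveʳ)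
open import Data.Sum.Base using (_⊎_; inj₁; inj₂; [_,_])
open import Function.Base using (_∘_; id; flip)
open import Function.Bundles using (mk⇔)
open import Relation.Binary.Definitions using (tri<; tri≈; tri>)
open import Relation.Binary.PropositionalEquality as ≡ using (_≡_; _≢_)
open import Relation.Binary.Structures using (IsEquivalence)
open import Relation.Nullary.Decidable using (yes; no; ¬?; decidable-stable; dec⇒maybe)
open import Relation.Nullary.Negation using (¬_; contradiction)

-- Skewness is what makes matrices possible: a product gate multiplies an earlier value by an atom,
-- so every gate is linear in the earlier gates and in a cell holding a fixed scalar `w`, of which
-- the inputs are read as multiples. Computing then means passing a row vector of cells through
-- matrices. The obstacle is that a matrix entry has to be a single atom: adding two inputs in one
-- step would need the entry a + b. Each gate is therefore spread over two steps, and since every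
-- step pushes one cell, the positions of all earlier gates are known beforehand. Linearity carries
-- `w` through to the output, so `w = 1 / 2m` cancels the factor 2m without further steps.
--
-- For the winding, let k of the m steps of a closed walk go forwards. Then k - (m - k) is 0 modulo
-- m, so m divides 2k; as m is odd and k ≤ m, k is 0 or m.
--
-- Equality with 0 in the field is not assumed decidable. Cotransitivity of the apartness selects m
-- or m + 2, and steps that copy the top cell pad the program to the selected length.

-- Congruences for the winding of closed walks

module Arithmetic where
  open import Data.Nat.Base using (_+_; _*_; _≤_; _<_)
  open import Relation.Binary.PropositionalEquality using (refl; sym; trans; cong; subst; module ≡-Reasoning)
  open +-*-Solver using (solve; con; _:+_; _:*_; _:=_)
  open ≡-Reasoning

  infix 4 _≡_mod_
  -- Multiples of m are added on both sides, which avoids subtraction of natural numbers.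
  _≡_mod_ : ℕ → ℕ → ℕ → Set
  x ≡ y mod m = ∃[ a ] ∃[ b ] x + a * m ≡ y + b * m

  %⇒mod : ∀ x y m .{{_ : NonZero m}} → x % m ≡ y → ∃[ q ] x ≡ y + q * m
  %⇒mod x y m x%m≡y = x / m , trans (m≡m%n+[m/n]*n x m) (cong (_+ x / m * m) x%m≡y)

  -- A walk of n steps, k of them forwards, moves from layer x to layer z = x + k - (n - k), that
  -- is, x + 2k ≡ z + n. Prepending a forward step raises both k and n; a backward step raises only
  -- n.
  mod-forward : ∀ {m x y z k n} → ∃[ q ] suc x ≡ y + q * m →
                y + 2 * k ≡ z + n mod m → x + 2 * suc k ≡ z + suc n mod m
  mod-forward {m} {x} {y} {z} {k} {n} (q , e) (a , b , e′) = a , q + b , (begin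
    x + 2 * suc k + a * m
      ≡⟨ solve 4 (λ x k a m → x :+ con 2 :* (con 1 :+ k) :+ a :* m
                           := (con 1 :+ x) :+ con 1 :+ con 2 :* k :+ a :* m) refl x k a m ⟩
    suc x + 1 + 2 * k + a * m
      ≡⟨ cong (λ w → w + 1 + 2 * k + a * m) e ⟩
    y + q * m + 1 + 2 * k + a * m
      ≡⟨ solve 5 (λ y q m k a → y :+ q :* m :+ con 1 :+ con 2 :* k :+ a :* m
                             := y :+ con 2 :* k :+ a :* m :+ (q :* m :+ con 1)) refl y q m k a ⟩
    y + 2 * k + a * m + (q * m + 1)
      ≡⟨ cong (_+ (q * m + 1)) e′ ⟩
    z + n + b * m + (q * m + 1)
      ≡⟨ solve 5 (λ z n b m q → z :+ n :+ b :* m :+ (q :* m :+ con 1)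
                             := z :+ (con 1 :+ n) :+ (q :+ b) :* m) refl z n b m q ⟩
    z + suc n + (q + b) * m ∎)

  mod-backward : ∀ {m x y z k n} → ∃[ q ] suc y ≡ x + q * m →
                 y + 2 * k ≡ z + n mod m → x + 2 * k ≡ z + suc n mod m
  mod-backward {m} {x} {y} {z} {k} {n} (q , e) (a , b , e′) = q + a , b , (begin
    x + 2 * k + (q + a) * m
      ≡⟨ solve 5 (λ x k q a m → x :+ con 2 :* k :+ (q :+ a) :* m
                             := x :+ q :* m :+ con 2 :* k :+ a :* m) refl x k q a m ⟩
    x + q * m + 2 * k + a * m
      ≡⟨ cong (λ w → w + 2 * k + a * m) e ⟨
    suc y + 2 * k + a * m
      ≡⟨ cong suc e′ ⟩
    suc (z + n + b * m)
      ≡⟨ solve 3 (λ z n w → con 1 :+ (z :+ n :+ w) := z :+ (con 1 :+ n) :+ w) refl z n (b * m) ⟩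
    z + suc n + b * m ∎)

  ∣-cancel-mod : ∀ {m x k} → x + 2 * k ≡ x + m mod m → m ∣ 2 * k
  ∣-cancel-mod {m} {x} {k} (a , b , e) = ∣m+n∣m⇒∣n
    (subst (m ∣_) (sym e′) (n∣m*n (suc b))) (n∣m*n a)
    where
    e′ : a * m + 2 * k ≡ suc b * m
    e′ = ℕ.+-cancelˡ-≡ x _ _ (begin
      x + (a * m + 2 * k)
        ≡⟨ solve 3 (λ x k w → x :+ (w :+ con 2 :* k) := x :+ con 2 :* k :+ w) refl x k (a * m) ⟩
      x + 2 * k + a * m
        ≡⟨ e ⟩
      x + m + b * m
        ≡⟨ ℕ.+-assoc x m (b * m) ⟩
      x + suc b * m ∎)

  coprime-odd-2 : ∀ j → Coprime (suc (2 * j)) 2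
  coprime-odd-2 j {d} (d∣odd , d∣2) =
    ∣1⇒≡1 (∣m+n∣m⇒∣n (subst (d ∣_) (ℕ.+-comm 1 _) d∣odd) (∣-trans d∣2 (m∣m*n j)))

  -- The congruence says that m divides 2k. Being odd, m is coprime to 2 and divides k, which is at
  -- most m.
  odd-winding : ∀ j {x k} (m : ℕ) → m ≡ suc (2 * j) → k ≤ m → x + 2 * k ≡ x + m mod m →
                k ≡ 0 ⊎ k ≡ m
  odd-winding j {k = zero}  m _ _ _ = inj₁ refl
  odd-winding j {x} {suc k} m refl k≤m e =
    inj₂ (ℕ.≤-antisym k≤m (∣⇒≤ (coprime-divisor (coprime-odd-2 j) (∣-cancel-mod {x = x} {suc k} e))))

  [m%n+o]%n≡[m+o]%n : ∀ m o n .{{_ : NonZero n}} → (m % n + o) % n ≡ (m + o) % n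
  [m%n+o]%n≡[m+o]%n m o n = begin
    (m % n + o) % n         ≡⟨ %-distribˡ-+ (m % n) o n ⟩
    (m % n % n + o % n) % n ≡⟨ cong (λ x → (x + o % n) % n) (m%n%n≡m%n m n) ⟩
    (m % n + o % n) % n     ≡⟨ %-distribˡ-+ m o n ⟨
    (m + o) % n             ∎

  m≤n⇒m%n≡0∨m%n≡m : ∀ {m n} .{{_ : NonZero n}} → m ≤ n → (m ≡ n × m % n ≡ 0) ⊎ m % n ≡ m
  m≤n⇒m%n≡0∨m%n≡m {m} {n} m≤n with ℕ.m≤n⇒m<n∨m≡n m≤n
  ... | inj₁ m<n  = inj₂ (m<n⇒m%n≡m m<n)
  ... | inj₂ refl = inj₁ (refl , n%n≡0 n)

  -- A cycle of length m ≥ 3 has neither loops nor cycles of length 2.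
  suc-%-≢ : ∀ {m a} .{{_ : NonZero m}} → 2 ≤ m → a < m → suc a % m ≢ a
  suc-%-≢ 2≤m a<m e with m≤n⇒m%n≡0∨m%n≡m a<m
  ... | inj₂ e′ = ℕ.1+n≢n (trans (sym e′) e)
  ... | inj₁ (refl , e′) with trans (sym e′) e
  ...   | refl = contradiction 2≤m λ { (s≤s ()) }

  suc-%-asym : ∀ {m a b} .{{_ : NonZero m}} → 3 ≤ m → a < m → b < m → suc a % m ≡ b → suc b % m ≢ a
  suc-%-asym 3≤m a<m b<m e f with m≤n⇒m%n≡0∨m%n≡m a<m | m≤n⇒m%n≡0∨m%n≡m b<m
  ... | inj₂ e′ | inj₂ f′ = ℕ.<-asym
    (ℕ.≤-reflexive (trans (sym e′) e)) (ℕ.≤-reflexive (trans (sym f′) f))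
  ... | inj₁ (refl , e′) | inj₁ (1+b≡m , _) with ℕ.suc-injective 1+b≡m | trans (sym e′) e
  ...   | refl | refl = contradiction 3≤m λ { (s≤s ()) }
  suc-%-asym 3≤m a<m b<m e f | inj₁ (refl , e′) | inj₂ f′ with trans (sym e′) e
  ... | refl with trans (sym f′) f
  ...   | refl = contradiction 3≤m λ { (s≤s (s≤s ())) }
  suc-%-asym 3≤m a<m b<m e f | inj₂ e′ | inj₁ (refl , f′) with trans (sym f′) f
  ... | refl with trans (sym e′) e
  ...   | refl = contradiction 3≤m λ { (s≤s (s≤s ())) }

-- Closure properties of polynomial bounds

module PolynomialBounds where
  open import Data.Nat.Base using (_+_; _*_; _^_; _≤_)
  open import Data.Nat.Properties
  open import Relation.Binary.PropositionalEquality using (refl; sym; cong)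
  open ≤-Reasoning

  -- Equivalent to PolyBounded, but visibly closed under sums and products.
  Bounded : (ℕ → ℕ) → Set
  Bounded t = ∃[ c ] ∀ n → t n ≤ (2 + n) ^ c

  n≤2^n : ∀ n → n ≤ 2 ^ n
  n≤2^n zero    = z≤n
  n≤2^n (suc n) = begin
    1 + n           ≤⟨ +-mono-≤ (m^n>0 2 n) (n≤2^n n) ⟩
    2 ^ n + 2 ^ n   ≡⟨ cong (2 ^ n +_) (+-identityʳ (2 ^ n)) ⟨
    2 ^ suc n       ∎

  n≤[2+m]^n : ∀ m n → n ≤ (2 + m) ^ n
  n≤[2+m]^n m n = ≤-trans (n≤2^n n) (^-monoˡ-≤ n (m≤m+n 2 m))

  m≤[2+n]*m : ∀ m n → m + m ≤ (2 + n) * m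
  m≤[2+n]*m m n = +-monoʳ-≤ m (m≤m+n m (n * m))

  polyBounded⇒bounded : ∀ {t} → PolyBounded t → Bounded t
  polyBounded⇒bounded {t} (c , t≤) = suc c , λ n → begin
    t n                         ≤⟨ t≤ n ⟩
    n ^ c + c                   ≤⟨ +-mono-≤ (^-monoˡ-≤ c (m≤n+m n 2)) (n≤[2+m]^n n c) ⟩
    (2 + n) ^ c + (2 + n) ^ c   ≤⟨ m≤[2+n]*m ((2 + n) ^ c) n ⟩
    (2 + n) ^ suc c             ∎

  -- For n ≥ 2 the exponent 2c suffices, because 2 + n ≤ n². The summand 3 ^ c covers n = 0 and n =
  -- 1, where raising the exponent gains nothing.
  bounded⇒polyBounded : ∀ {t} → Bounded t → PolyBounded t
  bounded⇒polyBounded {t} (c , t≤) = 2 * c + 3 ^ c , λ n → ≤-trans (t≤ n) (bound n)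
    where
    C = 2 * c + 3 ^ c
    bound : ∀ n → (2 + n) ^ c ≤ n ^ C + C
    bound zero = begin
      2 ^ c       ≤⟨ ^-monoˡ-≤ c (m≤m+n 2 1) ⟩
      3 ^ c       ≤⟨ m≤n+m (3 ^ c) (2 * c) ⟩
      C           ≤⟨ m≤n+m C (0 ^ C) ⟩
      0 ^ C + C   ∎
    bound (suc zero) = ≤-trans (m≤n+m (3 ^ c) (2 * c)) (m≤n+m C (1 ^ C))
    bound n@(suc (suc k)) = begin
      (2 + n) ^ c   ≤⟨ ^-monoˡ-≤ c 2+n≤n² ⟩
      (n ^ 2) ^ c   ≡⟨ ^-*-assoc n 2 c ⟩
      n ^ (2 * c)   ≤⟨ ^-monoʳ-≤ n (m≤m+n (2 * c) (3 ^ c)) ⟩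
      n ^ C         ≤⟨ m≤m+n _ C ⟩
      n ^ C + C     ∎
      where
      2+n≤n² : 2 + n ≤ n ^ 2
      2+n≤n² = begin
        2 + n                       ≤⟨ m≤m+n (2 + n) (3 * k + k * k) ⟩
        2 + n + (3 * k + k * k)     ≡⟨ solve 1 (λ k → con 4 :+ k :+ (con 3 :* k :+ k :* k)
                                                     := (con 2 :+ k) :* ((con 2 :+ k) :* con 1)) refl k ⟩
        n ^ 2                       ∎
        where open +-*-Solver using (solve; con; _:+_; _:*_; _:=_)

  bounded-const : ∀ a → Bounded (λ _ → a)
  bounded-const a = a , λ n → n≤[2+m]^n n a

  bounded-id : Bounded id
  bounded-id = 1 , λ n → ≤-trans (m≤n+m n 2) (≤-reflexive (sym (^-identityʳ (2 + n))))

  bounded-+ : ∀ {s t} → Bounded s → Bounded t → Bounded (λ n → s n + t n)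
  bounded-+ {s} {t} (c , s≤) (d , t≤) = suc (c + d) , λ n → begin
    s n + t n                             ≤⟨ +-mono-≤ (s≤ n) (t≤ n) ⟩
    (2 + n) ^ c + (2 + n) ^ d
      ≤⟨ +-mono-≤ (^-monoʳ-≤ (2 + n) (m≤m+n c d)) (^-monoʳ-≤ (2 + n) (m≤n+m d c)) ⟩
    (2 + n) ^ (c + d) + (2 + n) ^ (c + d) ≤⟨ m≤[2+n]*m ((2 + n) ^ (c + d)) n ⟩
    (2 + n) ^ suc (c + d)                 ∎

  bounded-* : ∀ {s t} → Bounded s → Bounded t → Bounded (λ n → s n * t n)
  bounded-* {s} {t} (c , s≤) (d , t≤) = c + d , λ n → begin
    s n * t n                   ≤⟨ *-mono-≤ (s≤ n) (t≤ n) ⟩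
    (2 + n) ^ c * (2 + n) ^ d   ≡⟨ ^-distribˡ-+-* (2 + n) c d ⟨
    (2 + n) ^ (c + d)           ∎

  bounded-≤ : ∀ {s t} → (∀ n → s n ≤ t n) → Bounded t → Bounded s
  bounded-≤ s≤t (c , t≤) = c , λ n → ≤-trans (s≤t n) (t≤ n)

-- Edges of cycles and of complete graphs

module GraphEdges where
  open import Data.Fin.Base using (_<_)
  open import Relation.Binary.PropositionalEquality using (refl; sym; trans; cong; cong₂; subst)

  module _ (n : ℕ) where
    private
      m : ℕ
      m = suc (suc (suc n))
      module G = Graph (cycle m)

    closingEdge : G.Vertex × G.Vertex
    closingEdge = zero , fromℕ _

    pathEdge : Fin (suc (suc n)) → G.Vertex × G.Vertex
    pathEdge i = inject₁ i , suc i

    cycleEdges : List (G.Vertex × G.Vertex)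
    cycleEdges = closingEdge ∷ map pathEdge (allFin (suc (suc n)))

    unique-edges : Unique G.edges
    unique-edges = Unique.filter⁺ G.isEdge?
      (Unique.cartesianProduct⁺ (Unique.allFin⁺ _) (Unique.allFin⁺ _))

    unique-cycleEdges : Unique cycleEdges
    unique-cycleEdges = All.tabulate closing∉path ∷
      Unique.map⁺ (λ e → Fin.suc-injective (,-injectiveʳ e)) (Unique.allFin⁺ _)
      where
      closing∉path : ∀ {e} → e ∈ map pathEdge (allFin _) → closingEdge ≢ e
      closing∉path e∈ refl with ∈-map⁻ pathEdge e∈
      ... | zero  , _ , e = contradiction (Fin.suc-injective (,-injectiveʳ e)) λ ()
      ... | suc i , _ , e = contradiction (,-injectiveˡ e) λ ()

    edge⇒cycleEdge : ∀ {e} → G.IsEdge e → e ∈ cycleEdges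
    edge⇒cycleEdge {u , suc v} (u<v , _ , inj₁ next) = there (subst
      (λ w → (w , suc v) ∈ map pathEdge (allFin _))
      (Fin.toℕ-injective (trans (Fin.toℕ-inject₁ v) (sym (ℕ.suc-injective
        (trans (sym (m<n⇒m%n≡m (ℕ.≤-<-trans u<v (Fin.toℕ<n (suc v))))) next)))))
      (∈-map⁺ pathEdge (∈-allFin v)))
    edge⇒cycleEdge {u , v} (u<v , _ , inj₂ next) with ℕ.m≤n⇒m<n∨m≡n (Fin.toℕ<n v)
    ... | inj₁ 1+v<m = contradiction (trans (sym (m<n⇒m%n≡m 1+v<m)) next)
                         λ e → ℕ.<⇒≱ u<v (ℕ.≤-trans (ℕ.n≤1+n _) (ℕ.≤-reflexive e))
    ... | inj₂ 1+v≡m = here (cong₂ _,_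
      (Fin.toℕ-injective (trans (sym next) (trans (cong (_% m) 1+v≡m) (n%n≡0 m))))
      (Fin.toℕ-injective (trans (ℕ.suc-injective 1+v≡m) (sym (Fin.toℕ-fromℕ _)))))

    cycleEdge⇒edge : ∀ {e} → e ∈ cycleEdges → G.IsEdge e
    cycleEdge⇒edge (here refl) = s≤s z≤n , (λ ()) ,
      inj₂ (trans (cong (λ x → suc x % m) (Fin.toℕ-fromℕ (suc (suc n)))) (n%n≡0 m))
    cycleEdge⇒edge (there e∈) with ∈-map⁻ pathEdge e∈
    ... | i , _ , refl = ℕ.≤-reflexive (cong suc (Fin.toℕ-inject₁ i)) ,
      (λ e → ℕ.1+n≢n (trans (sym (cong toℕ e)) (Fin.toℕ-inject₁ i))) ,
      inj₁ (trans (cong (λ x → suc x % m) (Fin.toℕ-inject₁ i)) (m<n⇒m%n≡m (Fin.toℕ<n (suc i))))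

    -- Both lists are free of duplicates and have the same members, so they agree as bags.
    edges-cycle : G.edges ↭ cycleEdges
    edges-cycle = ∼bag⇒↭ (unique∧set⇒bag unique-edges unique-cycleEdges (mk⇔
      (λ e∈ → edge⇒cycleEdge (proj₂
        (∈-filter⁻ G.isEdge? {xs = cartesianProduct (allFin _) (allFin _)} e∈)))
      (λ e∈ → let u<v , u~v = cycleEdge⇒edge e∈ in G.listed u<v u~v)))

  module _ (N : ℕ) where
    private module K = Graph (complete N)

    edge-sym : ∀ {u v} (u≢v : u ≢ v) (v≢u : v ≢ u) → K.edge {u} {v} u≢v ≡ K.edge {v} {u} v≢u
    edge-sym {u} {v} u≢v v≢u with Fin.<-cmp u v | Fin.<-cmp v u
    ... | tri< u<v _ _  | tri> _ _ u<v′ = cong (λ u<v → index (K.listed u<v u≢v)) (Fin.<-irrelevant u<v u<v′)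
    ... | tri> _ _ v<u  | tri< v<u′ _ _ = cong (λ v<u → index (K.listed v<u v≢u)) (Fin.<-irrelevant v<u v<u′)
    ... | tri≈ _ refl _ | _             = contradiction refl u≢v
    ... | _             | tri≈ _ refl _ = contradiction refl v≢u
    ... | tri< u<v _ _  | tri< v<u _ _  = contradiction v<u (Fin.<-asym u<v)
    ... | tri> _ _ v<u  | tri> _ _ u<v  = contradiction v<u (Fin.<-asym u<v)

  module _ (G : Graph) where
    private module G = Graph G

    edge-endpoints : ∀ {u v} (u~v : u G.~ v) → let e = G.edge u~v in
                     (G.src e ≡ u × G.tgt e ≡ v) ⊎ (G.src e ≡ v × G.tgt e ≡ u)
    edge-endpoints {u} {v} u~v with Fin.<-cmp u v
    ... | tri< u<v _ _  = let e = lookup-index (G.listed u<v u~v) in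
                          inj₁ (sym (,-injectiveˡ e) , sym (,-injectiveʳ e))
    ... | tri≈ _ refl _ = contradiction u~v G.~-irrefl
    ... | tri> _ _ v<u  = let e = lookup-index (G.listed v<u (G.~-sym u~v)) in
                          inj₂ (sym (,-injectiveˡ e) , sym (,-injectiveʳ e))

-- Traces of matrix products as sums over closed walks

module WalkSums {a ℓ : Level} (R : CommutativeSemiring a ℓ) where
  open Arithmetic
  import Algebra.Properties.Semiring.Sum (CommutativeSemiring.semiring R) as Sum
  open import Algebra.Properties.Semiring.Mult (CommutativeSemiring.semiring R) using () renaming (_×_ to _×′_)
  open CommutativeSemiring R hiding (zero)
  open import Relation.Binary.Reasoning.Setoid setoid

  -- The library's sum unfolds to a fold, from which unification cannot recover the summand.
  opaque
    sum : ∀ {n} → (Fin n → Carrier) → Carrier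
    sum = Sum.sum

    sum-suc : ∀ {n} (f : Fin (suc n) → Carrier) → sum f ≡ f zero + sum (f ∘ suc)
    sum-suc f = ≡.refl

    sum-empty : (f : Fin 0 → Carrier) → sum f ≡ 0#
    sum-empty f = ≡.refl

    sum-cong : ∀ {n} {f g : Fin n → Carrier} → (∀ i → f i ≈ g i) → sum f ≈ sum g
    sum-cong {n} = Sum.sum-cong-≋ {n}

    sum-+ : ∀ {n} (f g : Fin n → Carrier) → sum (λ i → f i + g i) ≈ sum f + sum g
    sum-+ {n} = Sum.∑-distrib-+ {n}

    sum-comm : ∀ {m n} (f : Fin m → Fin n → Carrier) →
               sum (λ i → sum (f i)) ≈ sum (λ j → sum λ i → f i j)
    sum-comm {m} {n} = Sum.∑-comm {m} {n}

    *-sum : ∀ {n} x (f : Fin n → Carrier) → x * sum f ≈ sum (λ i → x * f i)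
    *-sum {n} = Sum.*-distribˡ-sum {n}

    sum-* : ∀ {n} x (f : Fin n → Carrier) → sum f * x ≈ sum (λ i → f i * x)
    sum-* {n} = Sum.*-distribʳ-sum {n}

    sum-const : ∀ n x → sum {n} (λ _ → x) ≈ n ×′ x
    sum-const n x = Sum.sum-replicate n

    sum-zero : ∀ {n} (f : Fin n → Carrier) → (∀ i → f i ≈ 0#) → sum f ≈ 0#
    sum-zero {n} f f≈0 = trans (sum-cong f≈0) (Sum.sum-replicate-zero n)

    sum-single : ∀ {n} (f : Fin n → Carrier) k → (∀ i → i ≢ k → f i ≈ 0#) → sum f ≈ f k
    sum-single f zero    f≈0 =
      trans (+-congˡ (sum-zero (f ∘ suc) λ i → f≈0 (suc i) λ ())) (+-identityʳ _)
    sum-single f (suc k) f≈0 = trans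
      (+-cong (f≈0 zero λ ())
              (sum-single (f ∘ suc) k λ i i≢k → f≈0 (suc i) (i≢k ∘ Fin.suc-injective)))
      (+-identityˡ _)

    sum-↑ : ∀ m {n} (f : Fin (m ℕ.+ n) → Carrier) →
            sum f ≈ sum (λ i → f (i ↑ˡ n)) + sum (λ j → f (m ↑ʳ j))
    sum-↑ zero    f = sym (+-identityˡ _)
    sum-↑ (suc m) f = trans (+-congˡ (sum-↑ m (f ∘ suc))) (sym (+-assoc _ _ _))

    sum-combine : ∀ m {n} (f : Fin (m ℕ.* n) → Carrier) →
                  sum f ≈ sum (λ i → sum λ j → f (combine {m} {n} i j))
    sum-combine zero        f = refl
    sum-combine (suc m) {n} f = trans (sum-↑ n f) (+-congˡ (sum-combine m (f ∘ (n ↑ʳ_))))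

  zero-* : ∀ {x y} → x ≈ 0# → x * y ≈ 0#
  zero-* x≈0 = trans (*-congʳ x≈0) (zeroˡ _)

  *-zero : ∀ {x y} → y ≈ 0# → x * y ≈ 0#
  *-zero y≈0 = trans (*-congˡ y≈0) (zeroʳ _)

  Matrix : ℕ → Set a
  Matrix d = Fin d → Fin d → Carrier

  trace : ∀ {d} → Matrix d → Carrier
  trace A = sum λ i → A i i

  infixl 7 _·_

  _·_ : ∀ {d} → Matrix d → Matrix d → Matrix d
  (A · B) i k = sum λ j → A i j * B j k

  infix 4 _≈ᴹ_

  _≈ᴹ_ : ∀ {d} → Matrix d → Matrix d → Set ℓ
  A ≈ᴹ B = ∀ i j → A i j ≈ B i j

  ·-cong : ∀ {d} {A A′ B B′ : Matrix d} → A ≈ᴹ A′ → B ≈ᴹ B′ → A · B ≈ᴹ A′ · B′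
  ·-cong A≈A′ B≈B′ i k = sum-cong λ j → *-cong (A≈A′ i j) (B≈B′ j k)

  ·-assoc : ∀ {d} (A B C : Matrix d) → (A · B) · C ≈ᴹ A · (B · C)
  ·-assoc A B C i l = begin
    (sum λ k → (sum λ j → A i j * B j k) * C k l)
      ≈⟨ sum-cong (λ k → sum-* (C k l) _) ⟩
    (sum λ k → sum λ j → (A i j * B j k) * C k l)
      ≈⟨ sum-comm _ ⟩
    (sum λ j → sum λ k → (A i j * B j k) * C k l)
      ≈⟨ sum-cong (λ j → sum-cong λ k → *-assoc _ _ _) ⟩
    (sum λ j → sum λ k → A i j * (B j k * C k l))
      ≈⟨ sum-cong (λ j → sym (*-sum (A i j) _)) ⟩
    (sum λ j → A i j * (sum λ k → B j k * C k l)) ∎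

  trace-comm : ∀ {d} (A B : Matrix d) → trace (A · B) ≈ trace (B · A)
  trace-comm A B = trans (sum-comm _) (sum-cong λ j → sum-cong λ i → *-comm _ _)

  -- The product of M 0, …, M n: there are n + 1 factors.
  product : ∀ {d} → (ℕ → Matrix d) → ℕ → Matrix d
  product M zero    = M 0
  product M (suc n) = M 0 · product (M ∘ suc) n

  product-cong : ∀ {d} {M N : ℕ → Matrix d} n → (∀ i → i ℕ.≤ n → M i ≈ᴹ N i) →
                 product M n ≈ᴹ product N n
  product-cong zero    M≈N = M≈N 0 z≤n
  product-cong (suc n) M≈N =
    ·-cong (M≈N 0 z≤n) (product-cong n λ i i≤n → M≈N (suc i) (s≤s i≤n))

  product-snoc : ∀ {d} (M : ℕ → Matrix d) n → product M (suc n) ≈ᴹ product M n · M (suc n)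
  product-snoc M zero    i j = refl
  product-snoc M (suc n) i j = trans
    (·-cong {A = M 0} (λ _ _ → refl) (product-snoc (M ∘ suc) n) i j)
    (sym (·-assoc (M 0) (product (M ∘ suc) n) (M (suc (suc n))) i j))

  -- The hypothesis makes the shifted sequence a cyclic rotation of `M 0`, ..., `M n`, and a trace
  -- is invariant under rotation.
  trace-rotate : ∀ {d} (M : ℕ → Matrix d) n → M (suc n) ≈ᴹ M 0 →
                 trace (product M n) ≈ trace (product (M ∘ suc) n)
  trace-rotate M zero    Mₙ≈M₀ = sum-cong λ i → sym (Mₙ≈M₀ i i)
  trace-rotate M (suc n) Mₙ≈M₀ = begin
    trace (M 0 · product (M ∘ suc) n)
      ≈⟨ trace-comm (M 0) (product (M ∘ suc) n) ⟩
    trace (product (M ∘ suc) n · M 0)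
      ≈⟨ sum-cong (λ i → ·-cong {A = product (M ∘ suc) n} (λ _ _ → refl) (λ j k → sym (Mₙ≈M₀ j k)) i i) ⟩
    trace (product (M ∘ suc) n · M (suc (suc n)))
      ≈⟨ sum-cong (λ i → sym (product-snoc (M ∘ suc) n i i)) ⟩
    trace (product (M ∘ suc) (suc n)) ∎

  -- Serves to count the backward walks: a power of a matrix and the same power of its transpose
  -- have the same diagonal.
  product-transpose : ∀ {d} (A : Matrix d) n →
                      product (λ _ → flip A) n ≈ᴹ flip (product (λ _ → A) n)
  product-transpose A zero    i j = refl
  product-transpose A (suc n) i j = begin
    (flip A · product (λ _ → flip A) n) i j
      ≈⟨ ·-cong {A = flip A} (λ _ _ → refl) (product-transpose A n) i j ⟩
    (flip A · flip (product (λ _ → A) n)) i j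
      ≈⟨ sum-cong (λ _ → *-comm _ _) ⟩
    (product (λ _ → A) n · A) j i
      ≈⟨ product-snoc (λ _ → A) n j i ⟨
    product (λ _ → A) (suc n) j i ∎

  -- There are n + 1 steps, since φ lists only the n inner vertices.
  walk : ∀ {d} → Matrix d → (n : ℕ) → Fin d → (Fin n → Fin d) → Fin d → Carrier
  walk A zero    u φ v = A u v
  walk A (suc n) u φ v = A u (φ zero) * walk A n (φ zero) (φ ∘ suc) v

  closedWalk : ∀ {d} → Matrix d → (n : ℕ) → (Fin (suc n) → Fin d) → Carrier
  closedWalk A n φ = walk A n (φ zero) (φ ∘ suc) (φ zero)

  -- `finToFun` decodes a map by splitting its code into the first value and the code of the rest,
  -- which matches the recursion of `product`.
  sum-walks : ∀ {d} (A : Matrix d) n u v →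
              sum (λ i → walk A n u (finToFun {d} {n} i) v) ≈ product (λ _ → A) n u v
  sum-walks     A zero    u v = sum-single _ zero λ where
    zero 0≢0 → contradiction ≡.refl 0≢0
    (suc ())
  sum-walks {d} A (suc n) u v = begin
    (sum λ i → walk A (suc n) u (finToFun i) v)
      ≈⟨ sum-combine d _ ⟩
    (sum λ w → sum λ i → F (remQuot (d ℕ.^ n) (combine w i)))
      ≈⟨ sum-cong (λ w → sum-cong λ i → reflexive (≡.cong F (Fin.remQuot-combine w i))) ⟩
    (sum λ w → sum (λ i → A u w * walk A n w (finToFun i) v))
      ≈⟨ sum-cong (λ w → sym (*-sum (A u w) _)) ⟩
    (sum λ w → A u w * sum λ i → walk A n w (finToFun {d} {n} i) v)
      ≈⟨ sum-cong (λ w → *-congˡ (sum-walks A n w v)) ⟩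
    product (λ _ → A) (suc n) u v ∎
    where
    F : Fin d × Fin (d ℕ.^ n) → Carrier
    F (w , i) = A u w * walk A n w (finToFun i) v

  sum-closedWalks : ∀ {d} (A : Matrix d) n →
                    sum (λ i → closedWalk A n (finToFun {d} {suc n} i)) ≈ trace (product (λ _ → A) n)
  sum-closedWalks {d} A n = begin
    (sum λ i → closedWalk A n (finToFun i))
      ≈⟨ sum-combine d _ ⟩
    (sum λ u → sum λ i → F (remQuot (d ℕ.^ n) (combine u i)))
      ≈⟨ sum-cong (λ u → sum-cong λ i → reflexive (≡.cong F (Fin.remQuot-combine u i))) ⟩
    (sum λ u → sum λ i → walk A n u (finToFun i) u)
      ≈⟨ sum-cong (λ u → sum-walks A n u u) ⟩
    trace (product (λ _ → A) n) ∎
    where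
    F : Fin d × Fin (d ℕ.^ n) → Carrier
    F (u , i) = walk A n u (finToFun i) u

  -- The vertices lie in m cyclically arranged layers; the steps of weight A between them
  -- are split into forward steps B and backward steps C.
  module Layered {d m} .{{_ : NonZero m}} (A B C : Matrix d) (layer : Fin d → ℕ) where

    data Step (u v : Fin d) : Set ℓ where
      forward  : suc (layer u) % m ≡ layer v → A u v ≈ B u v → C u v ≈ 0# → Step u v
      backward : suc (layer v) % m ≡ layer u → A u v ≈ C u v → B u v ≈ 0# → Step u v
      none     : A u v ≈ 0# → B u v ≈ 0# → C u v ≈ 0# → Step u v

    module _ (step : ∀ u v → Step u v) where

      -- Here k counts the forward steps of a walk of length n + 1.
      record Count (n : ℕ) (u v : Fin d) (a b c : Carrier) : Set ℓ where
        constructor count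
        field
          k         : ℕ
          k≤1+n     : k ℕ.≤ suc n
          winding   : layer u ℕ.+ 2 ℕ.* k ≡ layer v ℕ.+ suc n mod m
          all-back  : k ≡ 0 → a ≈ c × b ≈ 0#
          all-forth : k ≡ suc n → a ≈ b × c ≈ 0#

      -- For walks that mix both directions only the congruence is recorded, not their weights: it
      -- is what rules them out once the walk is closed and has length m.
      classify : ∀ n u φ v → let a = walk A n u φ v; b = walk B n u φ v; c = walk C n u φ v in
                 (a ≈ 0# × b ≈ 0# × c ≈ 0#) ⊎ Count n u v a b c
      classify zero u φ v with step u v
      ... | forward  e A≈B C≈0 = inj₂ (count 1 ℕ.≤-refl
        (mod-forward {k = 0} {n = 0} (%⇒mod _ _ m e) (0 , 0 , ≡.refl)) (λ ()) (λ _ → A≈B , C≈0))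
      ... | backward e A≈C B≈0 = inj₂ (count 0 z≤n
        (mod-backward {k = 0} {n = 0} (%⇒mod _ _ m e) (0 , 0 , ≡.refl)) (λ _ → A≈C , B≈0) (λ ()))
      ... | none A≈0 B≈0 C≈0   = inj₁ (A≈0 , B≈0 , C≈0)
      classify (suc n) u φ v with step u (φ zero) | classify n (φ zero) (φ ∘ suc) v
      ... | none A≈0 B≈0 C≈0 | _ = inj₁ (zero-* A≈0 , zero-* B≈0 , zero-* C≈0)
      ... | _ | inj₁ (a≈0 , b≈0 , c≈0) = inj₁ (*-zero a≈0 , *-zero b≈0 , *-zero c≈0)
      ... | forward  e A≈B C≈0 | inj₂ (count k k≤ w back forth) = inj₂ (count (suc k) (s≤s k≤)
        (mod-forward (%⇒mod _ _ m e) w)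
        (λ ())
        (λ e → *-cong A≈B (proj₁ (forth (ℕ.suc-injective e))) , zero-* C≈0))
      ... | backward e A≈C B≈0 | inj₂ (count k k≤ w back forth) = inj₂ (count k (ℕ.m≤n⇒m≤1+n k≤)
        (mod-backward {k = k} (%⇒mod _ _ m e) w)
        (λ e → *-cong A≈C (proj₁ (back e)) , zero-* B≈0)
        -- The k forward steps all lie among the last n + 1 steps, so k cannot be n + 2.
        (λ e → contradiction (≡.subst (ℕ._≤ suc n) e k≤) ℕ.1+n≰n))

      -- A closed walk has equal layers at both ends, so `odd-winding` leaves only walks in a single
      -- direction; for these one summand is the weight and the other vanishes.
      closedWalk-split : ∀ j → m ≡ suc (2 ℕ.* j) → ∀ n → m ≡ suc n → ∀ φ →
        closedWalk A n φ ≈ closedWalk B n φ + closedWalk C n φ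
      closedWalk-split j odd n ≡.refl φ with classify n (φ zero) (φ ∘ suc) (φ zero)
      ... | inj₁ (a≈0 , b≈0 , c≈0) = trans a≈0 (sym (trans (+-cong b≈0 c≈0) (+-identityˡ 0#)))
      ... | inj₂ (count k k≤ w back forth) with odd-winding j m odd k≤ w
      ...   | inj₁ k≡0 = let a≈c , b≈0 = back k≡0 in
        trans a≈c (sym (trans (+-congʳ b≈0) (+-identityˡ _)))
      ...   | inj₂ k≡m = let a≈b , c≈0 = forth k≡m in
        trans a≈b (sym (trans (+-congˡ c≈0) (+-identityʳ _)))

      trace-split : ∀ j → m ≡ suc (2 ℕ.* j) → ∀ n → m ≡ suc n →
        trace (product (λ _ → A) n) ≈ trace (product (λ _ → B) n) + trace (product (λ _ → C) n)
      trace-split j odd n m≡1+n = begin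
        trace (product (λ _ → A) n)
          ≈⟨ sum-closedWalks A n ⟨
        sum (λ i → closedWalk A n (finToFun {d} {suc n} i))
          ≈⟨ sum-cong (λ i → closedWalk-split j odd n m≡1+n (finToFun i)) ⟩
        sum (λ i → closedWalk B n (finToFun {d} {suc n} i) + closedWalk C n (finToFun {d} {suc n} i))
          ≈⟨ sum-+ _ _ ⟩
        sum (λ i → closedWalk B n (finToFun {d} {suc n} i)) +
        sum (λ i → closedWalk C n (finToFun {d} {suc n} i))
          ≈⟨ +-cong (sum-closedWalks B n) (sum-closedWalks C n) ⟩
        trace (product (λ _ → B) n) + trace (product (λ _ → C) n) ∎

  -- Matrices laid around a cycle of layers

  module Blocks {m d} .{{_ : NonZero m}} (M : ℕ → Matrix d) where

    entry : Fin m × Fin d → Fin m × Fin d → Carrier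
    entry (c , j) (c′ , j′) with suc (toℕ c) % m ℕ.≟ toℕ c′
    ... | yes _ = M (toℕ c) j j′
    ... | no  _ = 0#

    entry-next : ∀ c j c′ j′ → suc (toℕ c) % m ≡ toℕ c′ → entry (c , j) (c′ , j′) ≈ M (toℕ c) j j′
    entry-next c j c′ j′ e with suc (toℕ c) % m ℕ.≟ toℕ c′
    ... | yes _ = refl
    ... | no ¬e = contradiction e ¬e

    entry-other : ∀ c j c′ j′ → suc (toℕ c) % m ≢ toℕ c′ → entry (c , j) (c′ , j′) ≈ 0#
    entry-other c j c′ j′ ¬e with suc (toℕ c) % m ℕ.≟ toℕ c′
    ... | yes e = contradiction e ¬e
    ... | no  _ = refl

    blocks : Matrix (m ℕ.* d)
    blocks u v = entry (remQuot d u) (remQuot d v)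

    layer : Fin (m ℕ.* d) → ℕ
    layer u = toℕ (quotient {m} d u)

    layer-% : ∀ u → layer u % m ≡ layer u
    layer-% u = m<n⇒m%n≡m (Fin.toℕ<n (quotient {m} d u))

    place : Fin (m ℕ.* d) → Fin d
    place u = remainder {m} d u

    -- The matrices in the order in which a forward walk starting in layer c meets them.
    from : ℕ → ℕ → Matrix d
    from c i = M ((c ℕ.+ i) % m)

    from-layer : ∀ u → from (layer u) 0 ≡ M (layer u)
    from-layer u = ≡.cong M (≡.trans (≡.cong (_% m) (ℕ.+-identityʳ (layer u))) (layer-% u))

    from-suc : ∀ c i → from c (suc i) ≡ from (suc c) i
    from-suc c i = ≡.cong (λ x → M (x % m)) (ℕ.+-suc c i)

    -- A layer leads only to the next one, so in the sum over the next vertex a single block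
    -- survives, and the remaining walk starts one layer later.
    blocks-product : ∀ n u v → (layer u ℕ.+ suc n) % m ≡ layer v →
                     product (λ _ → blocks) n u v ≈ product (from (layer u)) n (place u) (place v)
    blocks-product zero u v e = trans
      (entry-next _ _ _ _ (≡.trans (≡.cong (_% m) (ℕ.+-comm 1 (layer u))) e))
      (reflexive (≡.cong (λ A → A (place u) (place v)) (≡.sym (from-layer u))))
    blocks-product (suc n) u v e = begin
      sum (λ w → blocks u w * rest w)
        ≈⟨ sum-combine m _ ⟩
      sum (λ c → sum λ j → entry (remQuot d u) (remQuot d (combine c j)) * rest (combine c j))
        ≈⟨ sum-cong (λ c → sum-cong λ j → *-congʳ (reflexive
             (≡.cong (entry (remQuot d u)) (Fin.remQuot-combine c j)))) ⟩
      sum (λ c → sum λ j → entry (remQuot d u) (c , j) * rest (combine c j))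
        ≈⟨ sum-single _ next (λ c c≢ → sum-zero _ λ j → zero-* (entry-other _ _ c j λ e →
             c≢ (Fin.toℕ-injective (≡.trans (≡.sym e) (≡.sym next≡))))) ⟩
      sum (λ j → entry (remQuot d u) (next , j) * rest (combine next j))
        ≈⟨ sum-cong (λ j → *-cong
             (trans (entry-next _ _ next j (≡.sym next≡))
                    (reflexive (≡.cong (λ A → A (place u) j) (≡.sym (from-layer u)))))
             (rest≈ j)) ⟩
      product (from (layer u)) (suc n) (place u) (place v) ∎
      where
      rest : Fin (m ℕ.* d) → Carrier
      rest w = product (λ _ → blocks) n w v
      next : Fin m
      next = fromℕ< (m%n<n (suc (layer u)) m)
      next≡ : toℕ next ≡ suc (layer u) % m
      next≡ = Fin.toℕ-fromℕ< _
      layer≡ : ∀ j → layer (combine next j) ≡ suc (layer u) % m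
      layer≡ j = ≡.trans (≡.cong (toℕ ∘ proj₁) (Fin.remQuot-combine next j)) next≡
      shift : ∀ j i → (layer (combine next j) ℕ.+ i) % m ≡ (layer u ℕ.+ suc i) % m
      shift j i = ≡.trans (≡.cong (λ c → (c ℕ.+ i) % m) (layer≡ j)) (≡.trans
        ([m%n+o]%n≡[m+o]%n (suc (layer u)) i m) (≡.cong (_% m) (≡.sym (ℕ.+-suc (layer u) i))))
      rest≈ : ∀ j → rest (combine next j) ≈ product (from (layer u) ∘ suc) n j (place v)
      rest≈ j = begin
        rest (combine next j)
          ≈⟨ blocks-product n (combine next j) v (≡.trans (shift j (suc n)) e) ⟩
        product (from (layer (combine next j))) n (place (combine next j)) (place v)
          ≡⟨ ≡.cong (λ p → product (from (layer (combine next j))) n (proj₂ p) (place v))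
                    (Fin.remQuot-combine next j) ⟩
        product (from (layer (combine next j))) n j (place v)
          ≈⟨ product-cong n (λ i _ k l → reflexive (≡.cong (λ c → M c k l) (shift j i))) j (place v) ⟩
        product (from (layer u) ∘ suc) n j (place v) ∎

    -- Starting one layer later rotates the product cyclically, because the sequence has period m =
    -- n + 1.
    trace-from : ∀ n → m ≡ suc n → ∀ c → trace (product (from c) n) ≈ trace (product M n)
    trace-from n ≡.refl zero = sum-cong λ j → product-cong n
      (λ i i≤n k l → reflexive (≡.cong (λ c → M c k l) (m<n⇒m%n≡m (s≤s i≤n)))) j j
    trace-from n ≡.refl (suc c) = begin
      trace (product (from (suc c)) n)
        ≈⟨ sum-cong (λ j → product-cong n
             (λ i _ k l → reflexive (≡.cong (λ A → A k l) (≡.sym (from-suc c i)))) j j) ⟩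
      trace (product (from c ∘ suc) n)
        ≈⟨ trace-rotate (from c) n (λ k l → reflexive (≡.cong (λ c → M c k l)
             (≡.trans ([m+n]%n≡m%n c m) (≡.cong (_% m) (≡.sym (ℕ.+-identityʳ c)))))) ⟨
      trace (product (from c) n)
        ≈⟨ trace-from n ≡.refl c ⟩
      trace (product M n) ∎

    trace-blocks : ∀ n → m ≡ suc n → trace (product (λ _ → blocks) n) ≈ m ×′ trace (product M n)
    trace-blocks n ≡.refl = begin
      sum (λ u → product (λ _ → blocks) n u u)
        ≈⟨ sum-cong (λ u → blocks-product n u u (≡.trans ([m+n]%n≡m%n (layer u) m) (layer-% u))) ⟩
      sum (λ u → product (from (layer u)) n (place u) (place u))
        ≈⟨ sum-combine m _ ⟩
      sum (λ c → sum λ j → F (remQuot d (combine c j)))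
        ≈⟨ sum-cong (λ c → sum-cong λ j → reflexive (≡.cong F (Fin.remQuot-combine c j))) ⟩
      sum {m} (λ c → trace (product (from (toℕ c)) n))
        ≈⟨ sum-cong (λ c → trace-from n ≡.refl (toℕ c)) ⟩
      sum {m} (λ c → trace (product M n))
        ≈⟨ sum-const m _ ⟩
      m ×′ trace (product M n) ∎
      where
      F : Fin m × Fin d → Carrier
      F (c , j) = product (from (toℕ c)) n j j

    -- A is the weighted adjacency matrix of the undirected graph underlying blocks.
    module _ (A : Matrix (m ℕ.* d))
             (A-forward  : ∀ u v → suc (layer u) % m ≡ layer v → A u v ≈ M (layer u) (place u) (place v))
             (A-backward : ∀ u v → suc (layer v) % m ≡ layer u → A u v ≈ M (layer v) (place v) (place u))
             (A-none     : ∀ u v → suc (layer u) % m ≢ layer v → suc (layer v) % m ≢ layer u → A u v ≈ 0#)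
             (no-2-cycle : ∀ u v → suc (layer u) % m ≡ layer v → suc (layer v) % m ≢ layer u) where

      open Layered {m = m} A blocks (flip blocks) layer

      step : ∀ u v → Step u v
      step u v with suc (layer u) % m ℕ.≟ layer v | suc (layer v) % m ℕ.≟ layer u
      -- `no-2-cycle` keeps the two directions apart: the reversed block matrix vanishes on a
      -- forward step.
      ... | yes e | _      = forward e (trans (A-forward u v e) (sym (entry-next _ _ _ _ e)))
                                       (entry-other _ _ _ _ (no-2-cycle u v e))
      ... | no ¬e | yes e  = backward e (trans (A-backward u v e) (sym (entry-next _ _ _ _ e)))
                                        (entry-other _ _ _ _ ¬e)
      ... | no ¬e | no ¬e′ = none (A-none u v ¬e ¬e′) (entry-other _ _ _ _ ¬e) (entry-other _ _ _ _ ¬e′)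

      trace-undirected : ∀ k → m ≡ suc (2 ℕ.* k) → ∀ n → m ≡ suc n →
        trace (product (λ _ → A) n) ≈ m ×′ trace (product M n) + m ×′ trace (product M n)
      trace-undirected k odd n m≡1+n = begin
        trace (product (λ _ → A) n)
          ≈⟨ trace-split step k odd n m≡1+n ⟩
        trace (product (λ _ → blocks) n) + trace (product (λ _ → flip blocks) n)
          ≈⟨ +-congˡ (sum-cong λ u → product-transpose blocks n u u) ⟩
        trace (product (λ _ → blocks) n) + trace (product (λ _ → blocks) n)
          ≈⟨ +-cong (trace-blocks n m≡1+n) (trace-blocks n m≡1+n) ⟩
        m ×′ trace (product M n) + m ×′ trace (product M n) ∎

module Completeness {c ℓ₁ ℓ₂ : Level} (F : HeytingField c ℓ₁ ℓ₂) where
  open Arithmetic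
  open PolynomialBounds
  open GraphEdges
  private
    module F = HeytingField F
    module FR = CommutativeRing (HeytingCommutativeRing.commutativeRing F.heytingCommutativeRing)

  -- Polynomials as a commutative semiring

  polynomials : Set → CommutativeSemiring c (c ⊔ ℓ₁)
  polynomials X = record
    { Carrier = Poly F X
    ; _≈_     = _≋_ F
    ; _+_     = _⊕_
    ; _*_     = _⊗_
    ; 0#      = con F.0#
    ; 1#      = con F.1#
    ; isCommutativeSemiring = isCommutativeSemiringˡ record
      { +-isCommutativeMonoid = isCommutativeMonoidˡ record
        { isSemigroup = record { isMagma = record { isEquivalence = isEquiv ; ∙-cong = ⊕-cong }
                        ; assoc = ⊕-assoc }
        ; identityˡ = ⊕-identityˡ
        ; comm      = ⊕-comm
        }
      ; *-isCommutativeMonoid = isCommutativeMonoidˡ record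
        { isSemigroup = record { isMagma = record { isEquivalence = isEquiv ; ∙-cong = ⊗-cong }
                        ; assoc = ⊗-assoc }
        ; identityˡ = ⊗-identityˡ
        ; comm      = ⊗-comm
        }
      ; distribʳ = λ p q r →
          ≋-trans (⊗-comm _ _) (≋-trans (⊗-distribˡ p q r) (⊕-cong (⊗-comm _ _) (⊗-comm _ _)))
      ; zeroˡ    = ⊗-zeroˡ
      }
    }
    where
    isEquiv : IsEquivalence (_≋_ F {X})
    isEquiv = record { refl = ≋-refl ; sym = ≋-sym ; trans = ≋-trans }

  -- The homomorphism polynomial of a cycle as a trace

  module _ {X : Set} where
    open CommutativeSemiring (polynomials X) hiding (zero)
    open WalkSums (polynomials X)
    open import Relation.Binary.Reasoning.Setoid setoid

    ∑-cong : ∀ {A : Set} {f g : A → Poly F X} → (∀ x → f x ≈ g x) → ∀ xs →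
             ∑ F (map f xs) ≈ ∑ F (map g xs)
    ∑-cong f≈g []       = refl
    ∑-cong f≈g (x ∷ xs) = +-cong (f≈g x) (∑-cong f≈g xs)

    ∏-cong : ∀ {A : Set} {f g : A → Poly F X} → (∀ x → f x ≈ g x) → ∀ xs →
             ∏ F (map f xs) ≈ ∏ F (map g xs)
    ∏-cong f≈g []       = refl
    ∏-cong f≈g (x ∷ xs) = *-cong (f≈g x) (∏-cong f≈g xs)

    ∑-mapMaybe : ∀ {A B : Set} (h : A → Maybe B) {f : B → Poly F X} {g : A → Poly F X} →
                 (∀ x → maybe f 0# (h x) ≈ g x) → ∀ xs → ∑ F (map f (mapMaybe h xs)) ≈ ∑ F (map g xs)
    ∑-mapMaybe h f≈g []       = refl
    ∑-mapMaybe h f≈g (x ∷ xs) with h x | f≈g x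
    ... | just y  | fy≈gx = +-cong fy≈gx (∑-mapMaybe h f≈g xs)
    ... | nothing | 0≈gx  = trans (sym (+-identityˡ _)) (+-cong 0≈gx (∑-mapMaybe h f≈g xs))

    ∑-tabulate : ∀ {n} (f : Fin n → Poly F X) → ∑ F (tabulate f) ≈ sum f
    ∑-tabulate {zero}  f = reflexive (≡.sym (sum-empty f))
    ∑-tabulate {suc n} f = trans (+-congˡ (∑-tabulate (f ∘ suc))) (reflexive (≡.sym (sum-suc f)))

    ∏-↭ : ∀ {A : Set} (f : A → Poly F X) {xs ys} → xs ↭ ys → ∏ F (map f xs) ≈ ∏ F (map f ys)
    ∏-↭ f Perm.refl          = refl
    ∏-↭ f (Perm.prep x p)    = *-congˡ (∏-↭ f p)
    ∏-↭ f (Perm.swap x y p)  =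
      trans (sym (*-assoc _ _ _)) (trans (*-cong (*-comm _ _) (∏-↭ f p)) (*-assoc _ _ _))
    ∏-↭ f (Perm.trans p q)   = trans (∏-↭ f p) (∏-↭ f q)

    ∏-zero : ∀ {A : Set} {f : A → Poly F X} {xs} → Any (λ x → f x ≈ 0#) xs → ∏ F (map f xs) ≈ 0#
    ∏-zero (here fx≈0) = zero-* fx≈0
    ∏-zero (there any) = *-zero (∏-zero any)

    substitute-∑ : ∀ {A Y : Set} (σ : Y → Atom F X) (f : A → Poly F Y) xs →
                   substitute F σ (∑ F (map f xs)) ≡ ∑ F (map (substitute F σ ∘ f) xs)
    substitute-∑ σ f []       = ≡.refl
    substitute-∑ σ f (x ∷ xs) = ≡.cong (substitute F σ (f x) ⊕_) (substitute-∑ σ f xs)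

    substitute-∏ : ∀ {A Y : Set} (σ : Y → Atom F X) (f : A → Poly F Y) xs →
                   substitute F σ (∏ F (map f xs)) ≡ ∏ F (map (substitute F σ ∘ f) xs)
    substitute-∏ σ f []       = ≡.refl
    substitute-∏ σ f (x ∷ xs) = ≡.cong (substitute F σ (f x) ⊗_) (substitute-∏ σ f xs)

    map-lookup : ∀ {A : Set} (f : A → Poly F X) xs → map (f ∘ lookup xs) (allFin (length xs)) ≡ map f xs
    map-lookup f xs = ≡.trans (map-∘ (allFin _))
      (≡.cong (map f) (≡.trans (map-tabulate id (lookup xs)) (tabulate-lookup xs)))

    module _ (G : Graph) {N : ℕ} (σ : Graph.Edge (complete N) → Atom F X) (W : Matrix N)
             (W-loop : ∀ u → W u u ≈ 0#)
             (W-edge : ∀ {u v} (u≢v : u ≢ v) → ⟦_⟧ᵃ F (σ (Graph.edge (complete N) u≢v)) ≈ W u v) where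
      private module G = Graph G

      weight : (G.Vertex → Fin N) → Poly F X
      weight φ = ∏ F (map (λ (u , v) → W (φ u) (φ v)) G.edges)

      -- A map into a complete graph that is not a homomorphism collapses some edge to a loop, and
      -- loops weigh 0. Thus the sum over homomorphisms may be taken over all maps.
      weight-¬hom : ∀ φ → ¬ IsHom G (complete N) φ → 0# ≈ weight φ
      weight-¬hom φ ¬hom with All.all? (λ (u , v) → ¬? (φ u Fin.≟ φ v)) G.edges
      ... | yes proper = contradiction hom ¬hom
        where
        hom : IsHom G (complete N) φ
        hom u v u~v with Fin.<-cmp u v
        ... | tri< u<v _ _    = All.lookup proper (G.listed u<v u~v)
        ... | tri≈ _ ≡.refl _ = contradiction u~v G.~-irrefl
        ... | tri> _ _ v<u    = ≡.≢-sym (All.lookup proper (G.listed v<u (G.~-sym u~v)))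
      ... | no ¬proper = sym (∏-zero (Any.map
        (λ {(u , v)} ¬≢ →
          ≡.subst (λ w → W (φ u) w ≈ 0#) (decidable-stable (φ u Fin.≟ φ v) ¬≢) (W-loop (φ u)))
        (All.¬All⇒Any¬ (λ (u , v) → ¬? (φ u Fin.≟ φ v)) G.edges ¬proper)))

      maybe-hom : ∀ {f : Hom G (complete N) → Poly F X} → (∀ h → f h ≈ weight (proj₁ h)) → ∀ φ →
                  maybe f 0# (Maybe.map (φ ,_) (dec⇒maybe (isHom? G (complete N) φ))) ≈ weight φ
      maybe-hom f≈weight φ with isHom? G (complete N) φ
      ... | yes hom = f≈weight (φ , hom)
      ... | no ¬hom = weight-¬hom φ ¬hom

      substitute-homPoly : substitute F σ (homPoly F G (complete N)) ≈
                           sum (λ i → weight (finToFun {N} {G.order} i))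
      substitute-homPoly = begin
        substitute F σ (homPoly F G (complete N))
          ≡⟨ substitute-∑ σ _ (homs G (complete N)) ⟩
        ∑ F (map _ (homs G (complete N)))
          ≈⟨ ∑-mapMaybe _ (λ i → maybe-hom substitute-monomial (finToFun i))
               (allFin (N ℕ.^ G.order)) ⟩
        ∑ F (map (weight ∘ finToFun) (allFin (N ℕ.^ G.order)))
          ≡⟨ ≡.cong (∑ F) (map-tabulate id (weight ∘ finToFun)) ⟩
        ∑ F (tabulate (weight ∘ finToFun))
          ≈⟨ ∑-tabulate _ ⟩
        sum (λ i → weight (finToFun {N} {G.order} i)) ∎
        where
        substitute-monomial : ∀ ((φ , hom) : Hom G (complete N)) →
          substitute F σ (∏ F (map
            (λ e → var (Graph.edge (complete N) (hom (G.src e) (G.tgt e) (G.adjacent e))))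
            (allFin (length G.edges)))) ≈ weight φ
        substitute-monomial (φ , hom) = begin
          _ ≡⟨ substitute-∏ σ _ (allFin (length G.edges)) ⟩
          ∏ F (map _ (allFin (length G.edges)))
            ≈⟨ ∏-cong (λ e → W-edge (hom (G.src e) (G.tgt e) (G.adjacent e)))
                 (allFin (length G.edges)) ⟩
          ∏ F (map ((λ (u , v) → W (φ u) (φ v)) ∘ lookup G.edges) (allFin (length G.edges)))
            ≡⟨ ≡.cong (∏ F) (map-lookup _ G.edges) ⟩
          weight φ ∎

    -- The last step is pulled to the front because `cycleEdges` lists the closing edge first.
    walk-∏ : ∀ {N} (W : Matrix N) n (φ : Fin (suc n) → Fin N) v →
             walk W n (φ zero) (φ ∘ suc) v ≈
             W (φ (fromℕ n)) v * ∏ F (tabulate (λ i → W (φ (inject₁ i)) (φ (suc i))))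
    walk-∏ W zero    φ v = sym (*-identityʳ _)
    walk-∏ W (suc n) φ v = begin
      W (φ zero) (φ (suc zero)) * walk W n (φ (suc zero)) (λ i → φ (suc (suc i))) v
        ≈⟨ *-congˡ (walk-∏ W n (φ ∘ suc) v) ⟩
      W (φ zero) (φ (suc zero)) * (W (φ (fromℕ (suc n))) v * rest)
        ≈⟨ *-assoc _ _ _ ⟨
      W (φ zero) (φ (suc zero)) * W (φ (fromℕ (suc n))) v * rest
        ≈⟨ *-congʳ (*-comm _ _) ⟩
      W (φ (fromℕ (suc n))) v * W (φ zero) (φ (suc zero)) * rest
        ≈⟨ *-assoc _ _ _ ⟩
      W (φ (fromℕ (suc n))) v * (W (φ zero) (φ (suc zero)) * rest) ∎
      where
      rest : Poly F X
      rest = ∏ F (tabulate (λ i → W (φ (suc (inject₁ i))) (φ (suc (suc i)))))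

    module _ {N : ℕ} (σ : Graph.Edge (complete N) → Atom F X) (W : Matrix N)
             (W-loop : ∀ u → W u u ≈ 0#) (W-sym : ∀ u v → W u v ≈ W v u)
             (W-edge : ∀ {u v} (u≢v : u ≢ v) → ⟦_⟧ᵃ F (σ (Graph.edge (complete N) u≢v)) ≈ W u v) where

      weight-cycle : ∀ n φ →
        weight (cycle (suc (suc (suc n)))) σ W W-loop W-edge φ ≈ closedWalk W (suc (suc n)) φ
      weight-cycle n φ = begin
        weight (cycle (suc (suc (suc n)))) σ W W-loop W-edge φ
          ≈⟨ ∏-↭ _ (edges-cycle n) ⟩
        W (φ zero) (φ (fromℕ _)) * ∏ F (map _ (map (pathEdge n) (allFin _)))
          ≡⟨ ≡.cong (λ es → W (φ zero) (φ (fromℕ _)) * ∏ F es) (≡.trans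
               (≡.sym (map-∘ {g = λ (u , v) → W (φ u) (φ v)} {pathEdge n} (allFin _)))
               (map-tabulate id (λ i → W (φ (inject₁ i)) (φ (suc i))))) ⟩
        W (φ zero) (φ (fromℕ _)) * ∏ F (tabulate (λ i → W (φ (inject₁ i)) (φ (suc i))))
          -- The closing edge is listed with its smaller endpoint first, whereas the walk returns
          -- from the last vertex to vertex zero.
          ≈⟨ *-congʳ (W-sym _ _) ⟩
        W (φ (fromℕ _)) (φ zero) * ∏ F (tabulate (λ i → W (φ (inject₁ i)) (φ (suc i))))
          ≈⟨ walk-∏ W (suc (suc n)) φ (φ zero) ⟨
        closedWalk W (suc (suc n)) φ ∎

      -- Serves both halves of the theorem: with `indet` for σ it writes the polynomial itself as a
      -- trace, and with the layered weights it evaluates the projection.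
      substitute-cycle : ∀ n → 2 ℕ.≤ n →
        substitute F σ (homPoly F (cycle (suc n)) (complete N)) ≈ trace (product (λ _ → W) n)
      substitute-cycle n@(suc (suc l)) (s≤s (s≤s _)) = trans
        (substitute-homPoly (cycle (suc n)) σ W W-loop W-edge)
        (trans (sum-cong λ i → weight-cycle l (finToFun i)) (sum-closedWalks W n))

  -- Skew circuits for traces of matrix powers

  -- Each of the N * N entries is a sum of N products, at two gates per product: one multiplication
  -- and one addition.
  stepSize : ℕ → ℕ
  stepSize N = N ℕ.* N ℕ.* (N ℕ.* 2)

  traceSize : ℕ → ℕ → ℕ
  traceSize N n = N ℕ.* 2 ℕ.+ n ℕ.* stepSize N

  module _ {X : Set} where
    open CommutativeSemiring (polynomials X) hiding (zero)
    open WalkSums (polynomials X)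
    open import Relation.Binary.Reasoning.Setoid setoid

    ⟦_⟧ₐ : Atom F X → Poly F X
    ⟦_⟧ₐ = ⟦_⟧ᵃ F

    -- One circuit with many outputs, so that all entries of a matrix share the gates of the
    -- previous power.
    record Computes {I : Set} (p : I → Poly F X) (s : ℕ) : Set (c ⊔ ℓ₁) where
      field
        circuit : Circuit F X s
        skew    : Skew F circuit
        out     : I → Operand F X s
        correct : ∀ i → ⟦_⟧ᵒ F (out i) (⟦_⟧ F circuit) ≈ p i

    open Computes

    weaken : ∀ {s} → Operand F X s → Operand F X (suc s)
    weaken (input a) = input a
    weaken (gate i)  = gate (suc i)

    ⟦weaken⟧ : ∀ {s} {C : Circuit F X s} {g} o →
               ⟦_⟧ᵒ F (weaken o) (⟦_⟧ F (C ▷ g)) ≡ ⟦_⟧ᵒ F o (⟦_⟧ F C)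
    ⟦weaken⟧ (input a) = ≡.refl
    ⟦weaken⟧ (gate i)  = ≡.refl

    reindex : ∀ {I J p q s} (f : J → I) → (∀ j → p (f j) ≈ q j) → Computes {I} p s → Computes {J} q s
    reindex f p≈q D = record
      { circuit = circuit D ; skew = skew D ; out = out D ∘ f
      ; correct = λ j → trans (correct D (f j)) (p≈q j) }

    extend : ∀ {I p s} (D : Computes {I} p s) {g} → SkewGate F g → ∀ {q} →
             ⟦_⟧ᵍ F g (⟦_⟧ F (circuit D)) ≈ q → Computes (maybe p q) (suc s)
    extend D {g} skewGate g≈q = record
      { circuit = circuit D ▷ g
      ; skew    = skew D ▷ skewGate
      ; out     = maybe (weaken ∘ out D) (gate zero)
      ; correct = λ where
          (just i) → trans (reflexive (⟦weaken⟧ (out D i))) (correct D i)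
          nothing  → g≈q
      }

    combination : ∀ {I p s n} → Computes {I} p s → (a : Fin n → Atom F X) (x : Fin n → I) →
                  Computes (maybe p (sum λ i → ⟦ a i ⟧ₐ * p (x i))) (n ℕ.* 2 ℕ.+ s)
    combination {n = zero} D a x = record
      { circuit = circuit D
      ; skew    = skew D
      ; out     = maybe (out D) (input (const F.0#))
      ; correct = λ where
          (just i) → correct D i
          nothing  → reflexive (≡.sym (sum-empty _))
      }
    combination {I} {p} {n = suc n} D a x = reindex
      (maybe (just ∘ just ∘ just) nothing)
      (λ where
        (just i) → refl
        nothing  → reflexive (≡.sym (sum-suc _)))
      (extend scaled (add (out scaled nothing) (out scaled (just nothing)))
        (+-cong (correct scaled nothing) (correct scaled (just nothing))))
      where
      tail = combination D (a ∘ suc) (x ∘ suc)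
      scaled = extend tail (mul {x = input (a zero)} {out tail (just (x zero))} (inj₁ (input (a zero))))
        (*-congˡ (correct tail (just (x zero))))

    combinations : ∀ {I p s k n} → Computes {I} p s →
                   (a : Fin k → Fin n → Atom F X) (x : Fin k → Fin n → I) →
                   Computes {I ⊎ Fin k} [ p , (λ j → sum λ i → ⟦ a j i ⟧ₐ * p (x j i)) ]
                            (k ℕ.* (n ℕ.* 2) ℕ.+ s)
    combinations {k = zero} D a x = record
      { circuit = circuit D ; skew = skew D ; out = [ out D , (λ ()) ]
      ; correct = λ { (inj₁ i) → correct D i } }
    combinations {I} {p} {s} {suc k} {n} D a x = ≡.subst (Computes _)
      (≡.sym (ℕ.+-assoc (n ℕ.* 2) (k ℕ.* (n ℕ.* 2)) s))
      (reindex split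
        (λ where
          (inj₁ i)       → refl
          (inj₂ zero)    → refl
          (inj₂ (suc j)) → refl)
        (combination (combinations D (a ∘ suc) (x ∘ suc)) (a zero) (inj₁ ∘ x zero)))
      where
      split : I ⊎ Fin (suc k) → Maybe (I ⊎ Fin k)
      split (inj₁ i)       = just (inj₁ i)
      split (inj₂ zero)    = nothing
      split (inj₂ (suc j)) = just (inj₂ j)

    module _ {N} (S : Fin N → Fin N → Atom F X) where

      private
        W : Matrix N
        W u v = ⟦ S u v ⟧ₐ

      -- Repeated squaring would multiply gates by gates; multiplying by the matrix of atoms at each
      -- step keeps the circuit skew.
      power : ∀ n → Computes {Fin N × Fin N} (λ (u , v) → product (λ _ → W) n u v) (n ℕ.* stepSize N)
      power zero = record
        { circuit = [] ; skew = [] ; out = λ (u , v) → input (S u v) ; correct = λ _ → refl }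
      power (suc n) = reindex (λ (u , v) → inj₂ (combine u v))
        (λ (u , v) → reflexive (≡.cong value (Fin.remQuot-combine u v)))
        (combinations (power n)
          (λ j i → S (proj₁ (remQuot N j)) i)
          (λ j i → i , proj₂ (remQuot {N} N j)))
        where
        value : Fin N × Fin N → Poly F X
        value (u , v) = sum λ i → ⟦ S u i ⟧ₐ * product (λ _ → W) n i v

      trace-circuit : ∀ n {p} → trace (product (λ _ → W) n) ≈ p → SkewCircuitFor F p (traceSize N n)
      trace-circuit n trace≈p = record
        { circuit  = circuit D
        ; skew     = skew D
        ; output   = out D nothing
        ; computes = trans (correct D nothing) (trans (sum-cong λ u → *-identityˡ _) trace≈p)
        }
        where
        D = combination (power n) (λ _ → const F.1#) (λ u → u , u)

    substitute-indet : ∀ (p : Poly F X) → substitute F indet p ≡ p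
    substitute-indet (con a) = ≡.refl
    substitute-indet (var x) = ≡.refl
    substitute-indet (p ⊕ q) = ≡.cong₂ _⊕_ (substitute-indet p) (substitute-indet q)
    substitute-indet (p ⊗ q) = ≡.cong₂ _⊗_ (substitute-indet p) (substitute-indet q)

  module _ (N : ℕ) where
    private module K = Graph (complete N)
    open CommutativeSemiring (polynomials K.Edge) hiding (zero)
    open WalkSums (polynomials K.Edge)

    generic : K.Vertex → K.Vertex → Atom F K.Edge
    generic u v with u Fin.≟ v
    ... | yes _  = const F.0#
    ... | no u≢v = indet (K.edge u≢v)

    generic-loop : ∀ u → ⟦ generic u u ⟧ₐ ≈ 0#
    generic-loop u with u Fin.≟ u
    ... | yes _  = refl
    ... | no u≢u = contradiction ≡.refl u≢u

    generic-edge : ∀ {u v} (u≢v : u ≢ v) → var (K.edge u≢v) ≈ ⟦ generic u v ⟧ₐ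
    generic-edge {u} {v} u≢v with u Fin.≟ v
    ... | yes u≡v = contradiction u≡v u≢v
    ... | no u≢v′ = refl

    generic-sym : ∀ u v → ⟦ generic u v ⟧ₐ ≈ ⟦ generic v u ⟧ₐ
    generic-sym u v with u Fin.≟ v | v Fin.≟ u
    ... | yes _   | yes _   = refl
    ... | no u≢v  | no v≢u  = reflexive (≡.cong var (edge-sym N u≢v v≢u))
    ... | yes u≡v | no v≢u  = contradiction (≡.sym u≡v) v≢u
    ... | no u≢v  | yes v≡u = contradiction (≡.sym v≡u) u≢v

    homPoly-cycle : ∀ n → 2 ℕ.≤ n → trace (product (λ _ u v → ⟦ generic u v ⟧ₐ) n) ≈
                                     homPoly F (cycle (suc n)) (complete N)
    homPoly-cycle n 2≤n = trans
      (sym (substitute-cycle indet _ generic-loop generic-sym generic-edge n 2≤n))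
      (reflexive (substitute-indet _))

  -- Membership in VBP

  length-cartesianProduct : ∀ {A B : Set} (xs : List A) (ys : List B) →
                            length (cartesianProduct xs ys) ≡ length xs ℕ.* length ys
  length-cartesianProduct []       ys = ≡.refl
  length-cartesianProduct (x ∷ xs) ys = ≡.trans (length-++ (map (x ,_) ys))
    (≡.cong₂ ℕ._+_ (length-map (x ,_) ys) (length-cartesianProduct xs ys))

  length-edges : ∀ G → length (Graph.edges G) ℕ.≤ Graph.order G ℕ.* Graph.order G
  length-edges G = ℕ.≤-trans (length-filter G.isEdge? (cartesianProduct (allFin G.order) (allFin G.order)))
    (ℕ.≤-reflexive (≡.trans (length-cartesianProduct (allFin G.order) (allFin G.order))
      (≡.cong₂ ℕ._*_ (length-tabulate {n = G.order} id) (length-tabulate {n = G.order} id))))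
    where module G = Graph G

  module _ (G H : Graph) where
    private
      module G = Graph G
      module H = Graph H
    open CommutativeSemiring (polynomials H.Edge) hiding (zero)

    homPoly-degree : DegreeAtMost F (length G.edges) (homPoly F G H)
    homPoly-degree = map term (homs G H)
      , All.map⁺ (All.universal (λ h → ℕ.≤-reflexive (≡.trans
          (length-map _ (allFin (length G.edges))) (length-tabulate {n = length G.edges} id))) (homs G H))
      , trans (∑-cong (λ h → trans (sym (*-identityˡ _))
                (*-congˡ (reflexive (≡.cong (∏ F) (map-∘ (allFin (length G.edges))))))) (homs G H))
          (reflexive (≡.cong (∑ F) (map-∘ (homs G H))))
      where
      term : Hom G H → F.Carrier × List H.Edge
      term (φ , hom) = F.1# , map (λ e → H.edge (hom (G.src e) (G.tgt e) (G.adjacent e)))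
                                  (allFin (length G.edges))

  cycleFamily : Family F
  cycleFamily = homFamily F (λ k → cycle (suc (2 ℕ.* k))) (λ k → complete (suc (2 ℕ.* k) ℕ.^ 2))

  bounded-m : Bounded (λ k → suc (2 ℕ.* k))
  bounded-m = bounded-+ (bounded-const 1) (bounded-* (bounded-const 2) bounded-id)

  bounded-m² : Bounded (λ k → suc (2 ℕ.* k) ℕ.^ 2)
  bounded-m² = bounded-* bounded-m (bounded-* bounded-m (bounded-const 1))

  -- For k = 0 the polynomial is 1; the two idle gates bring the size to traceSize 1 0 = 2.
  circuits : ∀ k → SkewCircuitFor F (Family.poly cycleFamily k)
                                    (traceSize (suc (2 ℕ.* k) ℕ.^ 2) (2 ℕ.* k))
  circuits zero    = record
    { circuit  = [] ▷ add one one ▷ add one one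
    ; skew     = [] ▷ add _ _ ▷ add _ _
    ; output   = one
    ; computes = ≋-sym (≋-trans (⊕-comm _ _) (⊕-identityˡ _))
    }
    where
    one : ∀ {s} → Operand F (Graph.Edge (complete 1)) s
    one = input (const F.1#)
  circuits (suc k) = trace-circuit (generic N) (2 ℕ.* suc k)
    (homPoly-cycle N (2 ℕ.* suc k) (ℕ.*-monoʳ-≤ 2 (s≤s (z≤n {k}))))
    where N = suc (2 ℕ.* suc k) ℕ.^ 2

  membership : VBP F cycleFamily
  membership = record
    { isPFamily = record
      { numVars-bounded = bounded⇒polyBounded (bounded-≤
          (λ k → length-edges (complete (suc (2 ℕ.* k) ℕ.^ 2))) (bounded-* bounded-m² bounded-m²))
      ; degree = λ k → length (Graph.edges (cycle (suc (2 ℕ.* k))))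
      ; degree-bounded = bounded⇒polyBounded (bounded-≤
          (λ k → length-edges (cycle (suc (2 ℕ.* k)))) (bounded-* bounded-m bounded-m))
      ; hasDegree = λ k → homPoly-degree (cycle (suc (2 ℕ.* k))) (complete (suc (2 ℕ.* k) ℕ.^ 2))
      }
    ; size = λ k → traceSize (suc (2 ℕ.* k) ℕ.^ 2) (2 ℕ.* k)
    ; size-bounded = bounded⇒polyBounded (bounded-+ (bounded-* bounded-m² (bounded-const 2))
        (bounded-* (bounded-* (bounded-const 2) bounded-id)
          (bounded-* (bounded-* bounded-m² bounded-m²) (bounded-* bounded-m² (bounded-const 2)))))
    ; circuits = circuits
    }

  -- Skew circuits as products of matrices of atoms

  module _ {X : Set} where
    open CommutativeSemiring (polynomials X) hiding (zero)
    open WalkSums (polynomials X)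
    open import Relation.Binary.Reasoning.Setoid setoid

    pick : ℕ → Atom F X → Atom F X → ℕ → Atom F X
    pick u a b j with j ℕ.≟ u
    ... | yes _ = a
    ... | no  _ = b

    pick-≡ : ∀ u {a b} → pick u a b u ≡ a
    pick-≡ u with u ℕ.≟ u
    ... | yes _  = ≡.refl
    ... | no u≢u = contradiction ≡.refl u≢u

    pick-≢ : ∀ {u a b j} → j ≢ u → pick u a b j ≡ b
    pick-≢ {u} {j = j} j≢u with j ℕ.≟ u
    ... | yes j≡u = contradiction j≡u j≢u
    ... | no _    = ≡.refl

    0ₐ 1ₐ : Atom F X
    0ₐ = const F.0#
    1ₐ = const F.1#

    State : Set c
    State = ℕ → Poly F X

    Tap : Set c
    Tap = Atom F X × ℕ

    -- The instructions of a stack machine whose cell 0 is fixed and whose stack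
    -- starts with cell 1: push a multiple of a cell, added to the top by accumulate.
    data Instruction : Set c where
      load accumulate : Tap → Instruction

    tapValue : State → Tap → Poly F X
    tapValue st (a , u) = ⟦ a ⟧ₐ * st u

    value : Instruction → State → Poly F X
    value (load t)       st = tapValue st t
    value (accumulate t) st = st 1 + tapValue st t

    -- Even `accumulate` pushes and leaves the old top in cell 2, so that the position of a value
    -- depends only on the number of steps since it was computed.
    advance : Instruction → State → State
    advance x st 0             = st 0
    advance x st 1             = value x st
    advance x st (suc (suc k)) = st (suc k)

    run : List Instruction → State → State
    run xs st = foldl (λ st x → advance x st) st xs

    -- Since the entries of transition must be atoms, accumulate may not tap the top.
    column : Instruction → ℕ → Atom F X
    column (load (a , u))       j = pick u a 0ₐ j
    column (accumulate (a , u)) j = pick u a (pick 1 1ₐ 0ₐ j) j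

    transition : Instruction → ℕ → ℕ → Atom F X
    transition x j 0             = pick 0 1ₐ 0ₐ j
    transition x j 1             = column x j
    transition x j (suc (suc k)) = pick (suc k) 1ₐ 0ₐ j

    data Fits (d : ℕ) : Instruction → Set c where
      load       : ∀ {a u} → u ℕ.< d → Fits d (load (a , u))
      accumulate : ∀ {a u} → u ℕ.< d → u ≢ 1 → Fits d (accumulate (a , u))

    Fits-mono : ∀ {d d′ x} → d ℕ.≤ d′ → Fits d x → Fits d′ x
    Fits-mono d≤d′ (load u<d)           = load (ℕ.<-≤-trans u<d d≤d′)
    Fits-mono d≤d′ (accumulate u<d u≢1) = accumulate (ℕ.<-≤-trans u<d d≤d′) u≢1

    nth : List Instruction → ℕ → Instruction
    nth []       n       = load (0ₐ , 0)
    nth (x ∷ xs) zero    = x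
    nth (x ∷ xs) (suc n) = nth xs n

    -- Row 1 is the initial state, so that the trace reads off the final cell 1.
    closing : F.Carrier → ℕ → ℕ → Atom F X
    closing w j k = pick 1 (pick 0 (const w) 0ₐ k) 0ₐ j

    initial : F.Carrier → State
    initial w k = ⟦ pick 0 (const w) 0ₐ k ⟧ₐ

    matrices : F.Carrier → List Instruction → ℕ → ℕ → ℕ → Atom F X
    matrices w xs zero    = closing w
    matrices w xs (suc l) = transition (nth xs l)

    module _ {d : ℕ} where

      ⟦_⟧ᴹ : (ℕ → ℕ → Atom F X) → Matrix d
      ⟦ A ⟧ᴹ i j = ⟦ A (toℕ i) (toℕ j) ⟧ₐ

      sum-pick : ∀ (st : State) {a u} → u ℕ.< d →
                 sum {d} (λ j → st (toℕ j) * ⟦ pick u a 0ₐ (toℕ j) ⟧ₐ) ≈ ⟦ a ⟧ₐ * st u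
      sum-pick st {a} {u} u<d = begin
        sum (λ j → st (toℕ j) * ⟦ pick u a 0ₐ (toℕ j) ⟧ₐ)
          ≈⟨ sum-single {d} _ (fromℕ< u<d) (λ j j≢ → trans
               (*-congˡ (reflexive (≡.cong ⟦_⟧ₐ (pick-≢ λ j≡u →
                  j≢ (Fin.toℕ-injective (≡.trans j≡u (≡.sym (Fin.toℕ-fromℕ< u<d))))))))
               (zeroʳ _)) ⟩
        st (toℕ (fromℕ< u<d)) * ⟦ pick u a 0ₐ (toℕ (fromℕ< u<d)) ⟧ₐ
          ≡⟨ ≡.cong (λ j → st j * ⟦ pick u a 0ₐ j ⟧ₐ) (Fin.toℕ-fromℕ< u<d) ⟩
        st u * ⟦ pick u a 0ₐ u ⟧ₐ
          ≡⟨ ≡.cong (λ b → st u * ⟦ b ⟧ₐ) (pick-≡ u) ⟩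
        st u * ⟦ a ⟧ₐ
          ≈⟨ *-comm _ _ ⟩
        ⟦ a ⟧ₐ * st u ∎

      pick-+ : ∀ {u a} → u ≢ 1 → ∀ j →
               ⟦ pick u a (pick 1 1ₐ 0ₐ j) j ⟧ₐ ≈ ⟦ pick 1 1ₐ 0ₐ j ⟧ₐ + ⟦ pick u a 0ₐ j ⟧ₐ
      pick-+ {u} u≢1 j with j ℕ.≟ u
      ... | no  _      = sym (+-identityʳ _)
      ... | yes ≡.refl = sym (trans (+-congʳ (reflexive (≡.cong ⟦_⟧ₐ (pick-≢ u≢1)))) (+-identityˡ _))

      -- Cutting the infinite state down to d cells loses nothing: pushing moves contents only
      -- upwards, so a new cell below d depends only on old cells below d.
      sum-transition : ∀ (st : State) x → Fits d x → ∀ k → k ℕ.< d →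
                       sum {d} (λ j → st (toℕ j) * ⟦ transition x (toℕ j) k ⟧ₐ) ≈ advance x st k
      sum-transition st x fits zero 0<d = trans (sum-pick st 0<d) (*-identityˡ _)
      sum-transition st x fits (suc (suc k)) k<d = trans (sum-pick st (ℕ.<-trans (ℕ.n<1+n _) k<d)) (*-identityˡ _)
      sum-transition st (load _) (load u<d) 1 _ = sum-pick st u<d
      sum-transition st (accumulate (a , u)) (accumulate u<d u≢1) 1 1<d = begin
        sum {d} (λ j → st (toℕ j) * ⟦ pick u a (pick 1 1ₐ 0ₐ (toℕ j)) (toℕ j) ⟧ₐ)
          ≈⟨ sum-cong (λ j → trans (*-congˡ (pick-+ u≢1 (toℕ j))) (distribˡ _ _ _)) ⟩
        sum {d} (λ j → st (toℕ j) * ⟦ pick 1 1ₐ 0ₐ (toℕ j) ⟧ₐ + st (toℕ j) * ⟦ pick u a 0ₐ (toℕ j) ⟧ₐ)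
          ≈⟨ sum-+ _ _ ⟩
        sum {d} (λ j → st (toℕ j) * ⟦ pick 1 1ₐ 0ₐ (toℕ j) ⟧ₐ) +
        sum {d} (λ j → st (toℕ j) * ⟦ pick u a 0ₐ (toℕ j) ⟧ₐ)
          ≈⟨ +-cong (trans (sum-pick st 1<d) (*-identityˡ _)) (sum-pick st u<d) ⟩
        st 1 + ⟦ a ⟧ₐ * st u ∎

      sum-run : ∀ (st : State) x xs → All (Fits d) (x ∷ xs) → ∀ i →
                sum (λ j → st (toℕ j) * product (λ l → ⟦ transition (nth (x ∷ xs) l) ⟧ᴹ) (length xs) j i)
                ≈ run (x ∷ xs) st (toℕ i)
      sum-run st x []       (fits ∷ [])   i = sum-transition st x fits (toℕ i) (Fin.toℕ<n i)
      sum-run st x (y ∷ ys) (fits ∷ fits′) i = begin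
        sum (λ j → st (toℕ j) * (⟦ transition x ⟧ᴹ · rest) j i)
          -- The row vector `st` is regarded as a matrix with all rows equal, so that associativity
          -- of the matrix product applies.
          ≈⟨ ·-assoc (λ _ j → st (toℕ j)) ⟦ transition x ⟧ᴹ rest i i ⟨
        sum (λ k → sum (λ j → st (toℕ j) * ⟦ transition x ⟧ᴹ j k) * rest k i)
          ≈⟨ sum-cong (λ k → *-congʳ (sum-transition st x fits (toℕ k) (Fin.toℕ<n k))) ⟩
        sum (λ k → advance x st (toℕ k) * rest k i)
          ≈⟨ sum-run (advance x st) y ys fits′ i ⟩
        run (x ∷ y ∷ ys) st (toℕ i) ∎
        where
        rest : Matrix d
        rest = product (λ l → ⟦ transition (nth (y ∷ ys) l) ⟧ᴹ) (length ys)

      trace-matrices : ∀ w xs → All (Fits d) xs → 1 ℕ.< d → ∀ n → length xs ≡ suc n →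
                       trace (product (λ l → ⟦ matrices w xs l ⟧ᴹ) (suc n)) ≈ run xs (initial w) 1
      trace-matrices w (x ∷ xs) fits 1<d n ≡.refl = begin
        sum (λ j → sum λ k → ⟦ closing w (toℕ j) (toℕ k) ⟧ₐ * rest k j)
          ≈⟨ sum-single _ one (λ j j≢ → sum-zero _ λ k → trans
               (*-congʳ (reflexive (≡.cong ⟦_⟧ₐ (pick-≢ λ j≡1 →
                  j≢ (Fin.toℕ-injective (≡.trans j≡1 (≡.sym one≡1)))))))
               (zeroˡ _)) ⟩
        sum (λ k → ⟦ closing w (toℕ one) (toℕ k) ⟧ₐ * rest k one)
          ≈⟨ sum-cong (λ k → *-congʳ (reflexive (≡.cong ⟦_⟧ₐ (≡.trans
               (≡.cong (λ j → closing w j (toℕ k)) one≡1) (pick-≡ 1 {b = 0ₐ}))))) ⟩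
        sum (λ k → initial w (toℕ k) * rest k one)
          ≈⟨ sum-run (initial w) x xs fits one ⟩
        run (x ∷ xs) (initial w) (toℕ one)
          ≡⟨ ≡.cong (run (x ∷ xs) (initial w)) one≡1 ⟩
        run (x ∷ xs) (initial w) 1 ∎
        where
        one : Fin d
        one = fromℕ< 1<d
        one≡1 : toℕ one ≡ 1
        one≡1 = Fin.toℕ-fromℕ< 1<d
        rest : Matrix d
        rest = product (λ l → ⟦ transition (nth (x ∷ xs) l) ⟧ᴹ) (length xs)

    -- Every gate takes two cells, of which the first to be pushed is auxiliary.
    cell : ∀ {s} → Fin s → ℕ
    cell zero    = 1
    cell (suc i) = suc (suc (cell i))

    -- Inputs are read as multiples of cell 0. `tap↑` locates the operand after one further push, so
    -- it never points at the top, as `accumulate` requires.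
    tap tap↑ : ∀ {s} → Operand F X s → Tap
    tap (input a)  = a , 0
    tap (gate i)   = 1ₐ , cell i
    tap↑ (input a) = a , 0
    tap↑ (gate i)  = 1ₐ , suc (cell i)

    -- This is where skewness enters: the other operand is pushed, and the new top is then scaled by
    -- the atom.
    instructions : ∀ {s} {g : Gate F X s} → SkewGate F g → List Instruction
    instructions (add x y)                      = load (tap x) ∷ accumulate (tap↑ y) ∷ []
    instructions (mul {y = y} (inj₁ (input a))) = load (tap y) ∷ load (a , 1) ∷ []
    instructions (mul {x = x} (inj₂ (input a))) = load (tap x) ∷ load (a , 1) ∷ []

    compile : ∀ {s} {C : Circuit F X s} → Skew F C → List Instruction
    compile []      = []
    compile (C ▷ g) = compile C ++ instructions g

    length-compile : ∀ {s} {C : Circuit F X s} (sk : Skew F C) → length (compile sk) ≡ s ℕ.* 2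
    length-compile []               = ≡.refl
    length-compile (_▷_ {s} sk g) = ≡.trans (length-++ (compile sk))
      (≡.trans (≡.cong₂ ℕ._+_ (length-compile sk) (two g)) (ℕ.+-comm (s ℕ.* 2) 2))
      where
      two : ∀ {g} (sg : SkewGate F g) → length (instructions sg) ≡ 2
      two (add _ _)              = ≡.refl
      two (mul (inj₁ (input _))) = ≡.refl
      two (mul (inj₂ (input _))) = ≡.refl

    cell< : ∀ {s} (i : Fin s) → cell i ℕ.< s ℕ.* 2
    cell< {suc s} zero    = s≤s (s≤s z≤n)
    cell< {suc s} (suc i) = s≤s (s≤s (cell< i))

    tap< : ∀ {s} (o : Operand F X s) → proj₂ (tap o) ℕ.< suc s ℕ.* 2
    tap< (input a) = s≤s z≤n
    tap< (gate i)  = ℕ.m≤n⇒m≤1+n (ℕ.m≤n⇒m≤1+n (cell< i))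

    tap↑< : ∀ {s} (o : Operand F X s) → proj₂ (tap↑ o) ℕ.< suc s ℕ.* 2
    tap↑< (input a) = s≤s z≤n
    tap↑< (gate i)  = s≤s (ℕ.m≤n⇒m≤1+n (cell< i))

    tap↑≢1 : ∀ {s} (o : Operand F X s) → proj₂ (tap↑ o) ≢ 1
    tap↑≢1 (input a)      ()
    tap↑≢1 (gate zero)    ()
    tap↑≢1 (gate (suc i)) ()

    fits-instructions : ∀ {s} {g : Gate F X s} (sg : SkewGate F g) →
                        All (Fits (suc s ℕ.* 2)) (instructions sg)
    fits-instructions (add x y) = load (tap< x) ∷ accumulate (tap↑< y) (tap↑≢1 y) ∷ []
    fits-instructions (mul {y = y} (inj₁ (input a))) = load (tap< y) ∷ load (s≤s (s≤s z≤n)) ∷ []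
    fits-instructions (mul {x = x} (inj₂ (input a))) = load (tap< x) ∷ load (s≤s (s≤s z≤n)) ∷ []

    fits-compile : ∀ {s} {C : Circuit F X s} (sk : Skew F C) → All (Fits (s ℕ.* 2)) (compile sk)
    fits-compile []       = []
    fits-compile (_▷_ {s} sk g) = All.++⁺
      (All.map (Fits-mono (ℕ.m≤n+m (s ℕ.* 2) 2)) (fits-compile sk)) (fits-instructions g)

    -- Every value carries the factor w of cell 0 exactly once, because a product gate multiplies a
    -- scaled value by an unscaled atom.
    record Simulates (w : Poly F X) {s} (C : Circuit F X s) (st : State) : Set (c ⊔ ℓ₁) where
      constructor simulates
      field
        unit  : st 0 ≈ w
        gates : ∀ i → st (cell i) ≈ ⟦_⟧ F C i * w

    open Simulates

    simulates-tap : ∀ {w s st} {C : Circuit F X s} → Simulates w C st → ∀ o →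
                    tapValue st (tap o) ≈ ⟦_⟧ᵒ F o (⟦_⟧ F C) * w
    simulates-tap sim (input a) = *-congˡ (unit sim)
    simulates-tap sim (gate i)  = trans (*-identityˡ _) (gates sim i)

    simulates-tap↑ : ∀ {w s st} {C : Circuit F X s} x → Simulates w C st → ∀ o →
                     tapValue (advance x st) (tap↑ o) ≈ ⟦_⟧ᵒ F o (⟦_⟧ F C) * w
    simulates-tap↑ x sim (input a)      = *-congˡ (unit sim)
    simulates-tap↑ x sim (gate zero)    = trans (*-identityˡ _) (gates sim zero)
    simulates-tap↑ x sim (gate (suc i)) = trans (*-identityˡ _) (gates sim (suc i))

    simulates-gate : ∀ {w s st} {C : Circuit F X s} {g : Gate F X s} x y → Simulates w C st →
                     value y (advance x st) ≈ ⟦_⟧ᵍ F g (⟦_⟧ F C) * w →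
                     Simulates w (C ▷ g) (advance y (advance x st))
    simulates-gate {w} {st = st} {C} {g} x y sim value≈ = simulates (unit sim) cells
      where
      cells : ∀ i → advance y (advance x st) (cell i) ≈ ⟦_⟧ F (C ▷ g) i * w
      cells zero          = value≈
      cells (suc zero)    = gates sim zero
      cells (suc (suc i)) = gates sim (suc i)

    run-instructions : ∀ {w s st} {C : Circuit F X s} {g} (sg : SkewGate F g) → Simulates w C st →
                       Simulates w (C ▷ g) (run (instructions sg) st)
    run-instructions (add x y) sim = simulates-gate (load (tap x)) (accumulate (tap↑ y)) sim (trans
      (+-cong (simulates-tap sim x) (simulates-tap↑ (load (tap x)) sim y)) (sym (distribʳ _ _ _)))
    run-instructions (mul {y = y} (inj₁ (input a))) sim = simulates-gate (load (tap y)) (load (a , 1)) sim (trans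
      (*-congˡ (simulates-tap sim y)) (sym (*-assoc _ _ _)))
    run-instructions (mul {x = x} (inj₂ (input a))) sim = simulates-gate (load (tap x)) (load (a , 1)) sim (trans
      (*-congˡ (simulates-tap sim x)) (trans (sym (*-assoc _ _ _)) (*-congʳ (*-comm _ _))))

    run-++ : ∀ xs ys st → run (xs ++ ys) st ≡ run ys (run xs st)
    run-++ xs ys st = foldl-++ (λ st x → advance x st) st xs ys

    run-compile : ∀ {w s st} {C : Circuit F X s} (sk : Skew F C) → st 0 ≈ w →
                  Simulates w C (run (compile sk) st)
    run-compile []       st₀≈w = simulates st₀≈w λ ()
    run-compile {w} {st = st} (_▷_ {C = C} {g} sk sg) st₀≈w = ≡.subst (Simulates w (C ▷ g))
      (≡.sym (run-++ (compile sk) (instructions sg) st)) (run-instructions sg (run-compile sk st₀≈w))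

    hold : Instruction
    hold = load (1ₐ , 1)

    run-hold : ∀ e st → run (replicate e hold) st 1 ≈ st 1
    run-hold zero    st = refl
    run-hold (suc e) st = trans (run-hold e (advance hold st)) (*-identityˡ _)

    module _ {s} {C : Circuit F X s} (sk : Skew F C) (o : Operand F X s) (e : ℕ) where

      -- The extra `load` brings the output to the top even if it is an input or not the last gate;
      -- the copies of `hold` are padding.
      program : List Instruction
      program = compile sk ++ load (tap o) ∷ replicate e hold

      length-program : length program ≡ s ℕ.* 2 ℕ.+ suc e
      length-program = ≡.trans (length-++ (compile sk))
        (≡.cong₂ ℕ._+_ (length-compile sk) (≡.cong suc (length-replicate e)))

      fits-program : All (Fits (suc s ℕ.* 2)) program
      fits-program = All.++⁺ (All.map (Fits-mono (ℕ.m≤n+m (s ℕ.* 2) 2)) (fits-compile sk))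
        (load (tap< o) ∷ All.replicate⁺ e (load (s≤s (s≤s z≤n))))

      run-program : ∀ {w} → run program (initial w) 1 ≈ ⟦_⟧ᵒ F o (⟦_⟧ F C) * con w
      run-program {w} = begin
        run program (initial w) 1
          ≡⟨ ≡.cong (λ st → st 1) (run-++ (compile sk) (load (tap o) ∷ replicate e hold) (initial w)) ⟩
        run (replicate e hold) (advance (load (tap o)) (run (compile sk) (initial w))) 1
          ≈⟨ run-hold e _ ⟩
        tapValue (run (compile sk) (initial w)) (tap o)
          ≈⟨ simulates-tap (run-compile sk refl) o ⟩
        ⟦_⟧ᵒ F o (⟦_⟧ F C) * con w ∎

  -- The substitution that lays the matrices around a cycle

  module _ {X : Set} {m d : ℕ} .{{_ : NonZero m}} (3≤m : 3 ℕ.≤ m)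
           (M : ℕ → Fin d → Fin d → Atom F X) where
    open CommutativeSemiring (polynomials X) hiding (zero)
    open WalkSums (polynomials X)
    open import Algebra.Properties.Semiring.Mult semiring using () renaming (_×_ to _×′_)
    open Blocks {m} {d} (λ l i j → ⟦ M l i j ⟧ₐ) using (layer; place; trace-undirected)

    layered : Fin (m ℕ.* d) → Fin (m ℕ.* d) → Atom F X
    layered u v with suc (layer u) % m ℕ.≟ layer v | suc (layer v) % m ℕ.≟ layer u
    ... | yes _ | _     = M (layer u) (place u) (place v)
    ... | no _  | yes _ = M (layer v) (place v) (place u)
    ... | no _  | no _  = 0ₐ

    layer< : ∀ u → layer u ℕ.< m
    layer< u = Fin.toℕ<n _

    asym : ∀ u v → suc (layer u) % m ≡ layer v → suc (layer v) % m ≢ layer u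
    asym u v = suc-%-asym 3≤m (layer< u) (layer< v)

    layered-forward : ∀ u v → suc (layer u) % m ≡ layer v → layered u v ≡ M (layer u) (place u) (place v)
    layered-forward u v e with suc (layer u) % m ℕ.≟ layer v
    ... | yes _ = ≡.refl
    ... | no ¬e = contradiction e ¬e

    layered-backward : ∀ u v → suc (layer v) % m ≡ layer u → layered u v ≡ M (layer v) (place v) (place u)
    layered-backward u v e with suc (layer u) % m ℕ.≟ layer v | suc (layer v) % m ℕ.≟ layer u
    ... | yes e′ | _     = contradiction e (asym u v e′)
    ... | no _   | yes _ = ≡.refl
    ... | no _   | no ¬e = contradiction e ¬e

    layered-none : ∀ u v → suc (layer u) % m ≢ layer v → suc (layer v) % m ≢ layer u → layered u v ≡ 0ₐ
    layered-none u v ¬e ¬e′ with suc (layer u) % m ℕ.≟ layer v | suc (layer v) % m ℕ.≟ layer u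
    ... | yes e | _      = contradiction e ¬e
    ... | no _  | yes e′ = contradiction e′ ¬e′
    ... | no _  | no _   = ≡.refl

    layered-sym : ∀ u v → layered u v ≡ layered v u
    layered-sym u v with suc (layer u) % m ℕ.≟ layer v | suc (layer v) % m ℕ.≟ layer u
    ... | yes e | yes e′ = contradiction e′ (asym u v e)
    ... | yes _ | no _   = ≡.refl
    ... | no _  | yes _  = ≡.refl
    ... | no _  | no _   = ≡.refl

    layered-loop : ∀ u → layered u u ≡ 0ₐ
    layered-loop u = layered-none u u loop loop
      where loop = suc-%-≢ (ℕ.≤-trans (ℕ.n≤1+n 2) 3≤m) (layer< u)

    private module K = Graph (complete (m ℕ.* d))

    σ : K.Edge → Atom F X
    σ e = layered (K.src e) (K.tgt e)

    -- An edge stores its endpoints in increasing order, possibly against the order of u and v; the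
    -- symmetry of `layered` compensates for this.
    σ-edge : ∀ {u v} (u≢v : u ≢ v) → ⟦ σ (K.edge u≢v) ⟧ₐ ≈ ⟦ layered u v ⟧ₐ
    σ-edge {u} {v} u≢v with edge-endpoints (complete (m ℕ.* d)) u≢v
    ... | inj₁ (s , t) = reflexive (≡.cong ⟦_⟧ₐ (≡.cong₂ layered s t))
    ... | inj₂ (s , t) = reflexive (≡.cong ⟦_⟧ₐ (≡.trans (≡.cong₂ layered s t) (layered-sym v u)))

    substitute-layered : ∀ k n → m ≡ suc (2 ℕ.* k) → m ≡ suc n →
      let T = trace (product (λ l i j → ⟦ M l i j ⟧ₐ) n) in
      substitute F σ (homPoly F (cycle (suc n)) (complete (m ℕ.* d))) ≈ m ×′ T + m ×′ T
    substitute-layered k n odd ≡.refl = trans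
      (substitute-cycle σ (λ u v → ⟦ layered u v ⟧ₐ)
        (λ u → reflexive (≡.cong ⟦_⟧ₐ (layered-loop u)))
        (λ u v → reflexive (≡.cong ⟦_⟧ₐ (layered-sym u v)))
        σ-edge n (ℕ.s≤s⁻¹ 3≤m))
      (trace-undirected (λ u v → ⟦ layered u v ⟧ₐ)
        (λ u v e → reflexive (≡.cong ⟦_⟧ₐ (layered-forward u v e)))
        (λ u v e → reflexive (≡.cong ⟦_⟧ₐ (layered-backward u v e)))
        (λ u v e e′ → reflexive (≡.cong ⟦_⟧ₐ (layered-none u v e e′)))
        asym k odd n ≡.refl)

  -- Invertibility of 2m

  module Scalar where
    open FR
    open import Algebra.Properties.Semiring.Mult FR.semiring
      using (×-congʳ; ×-assoc-*) renaming (_×_ to _×′_)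
    open import Relation.Binary.Reasoning.Setoid setoid

    Invertible : Carrier → Set (c ⊔ ℓ₁)
    Invertible x = ∃[ y ] x * y ≈ 1#

    -- Apartness of two elements amounts to invertibility of their difference; for 2 + x and x this
    -- is the difference that comes with 2 being apart from 0.
    2+x-x : ∀ x → ((1# + 1#) + x) - x ≈ (1# + 1#) - 0#
    2+x-x x = begin
      ((1# + 1#) + x) - x     ≈⟨ +-assoc _ _ _ ⟩
      (1# + 1#) + (x - x)     ≈⟨ +-congˡ (-‿inverseʳ x) ⟩
      (1# + 1#) + 0#          ≈⟨ +-congˡ (trans (sym (-‿inverseʳ 0#)) (+-identityˡ _)) ⟩
      (1# + 1#) - 0#          ∎

    x-0 : ∀ x → x - 0# ≈ x
    x-0 x = trans (+-congˡ (trans (sym (+-identityˡ _)) (-‿inverseʳ 0#))) (+-identityʳ x)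

    #0⇒invertible : ∀ {x} → x F.# 0# → Invertible x
    #0⇒invertible {x} x#0 = let y , _ , xy≈1 = F.#⇒invertible x#0 in
      y , trans (*-congʳ (sym (x-0 x))) xy≈1

    -- Of x and x + 2 one is apart from 0, since their difference is.
    invertible-+2 : (1# + 1#) F.# 0# → ∀ x → Invertible x ⊎ Invertible ((1# + 1#) + x)
    invertible-+2 2#0 x with F.#⇒invertible 2#0
    ... | y , y2≈1 , 2y≈1 with F.#-cotrans (F.invertible⇒# {(1# + 1#) + x} {x}
            (y , trans (*-congˡ (2+x-x x)) y2≈1 , trans (*-congʳ (2+x-x x)) 2y≈1)) 0#
    ...   | inj₁ 2+x#0 = inj₂ (#0⇒invertible 2+x#0)
    ...   | inj₂ 0#x   = inj₁ (#0⇒invertible (F.#-sym 0#x))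

    odd# : ℕ → Carrier
    odd# k = suc (2 ℕ.* k) ×′ 1#

    odd#-suc : ∀ k → odd# (suc k) ≈ (1# + 1#) + odd# k
    odd#-suc k = trans (reflexive (≡.cong (_×′ 1#) (≡.cong suc (ℕ.*-suc 2 k)))) (sym (+-assoc _ _ _))

    -- Raising k by one raises 2k + 1 by two, so e ≤ 1 is enough and the index of the projection
    -- stays polynomially bounded.
    choose : (1# + 1#) F.# 0# → ∀ k → ∃[ e ] e ℕ.≤ 1 × Invertible (odd# (e ℕ.+ k))
    choose 2#0 k with invertible-+2 2#0 (odd# k)
    ... | inj₁ inv          = 0 , z≤n , inv
    ... | inj₂ (y , 2+ky≈1) = 1 , ℕ.≤-refl , y , trans (*-congʳ (odd#-suc k)) 2+ky≈1

    double-inverse : (1# + 1#) F.# 0# → ∀ m → Invertible (m ×′ 1#) → ∃[ w ] m ×′ w + m ×′ w ≈ 1#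
    double-inverse 2#0 m (y , my≈1) with #0⇒invertible 2#0
    ... | h , 2h≈1 = y * h , (begin
      m ×′ (y * h) + m ×′ (y * h)   ≈⟨ +-cong mw≈h mw≈h ⟩
      h + h                         ≈⟨ +-cong (*-identityˡ h) (*-identityˡ h) ⟨
      1# * h + 1# * h               ≈⟨ distribʳ h 1# 1# ⟨
      (1# + 1#) * h                 ≈⟨ 2h≈1 ⟩
      1#                            ∎)
      where
      mw≈h : m ×′ (y * h) ≈ h
      mw≈h = begin
        m ×′ (y * h)          ≈⟨ ×-congʳ m (*-identityˡ (y * h)) ⟨
        m ×′ (1# * (y * h))   ≈⟨ ×-assoc-* m 1# (y * h) ⟨
        (m ×′ 1#) * (y * h)   ≈⟨ *-assoc _ _ _ ⟨
        (m ×′ 1#) * y * h     ≈⟨ *-congʳ my≈1 ⟩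
        1# * h                ≈⟨ *-identityˡ h ⟩
        h                     ∎

  -- Hardness for VBP

  module _ {X : Set} where
    open CommutativeSemiring (polynomials X) hiding (zero)
    open import Algebra.Properties.Semiring.Mult semiring using (×-congʳ) renaming (_×_ to _×′_)
    open import Algebra.Properties.Semiring.Mult FR.semiring using () renaming (_×_ to _×″_)
    open import Relation.Binary.Reasoning.Setoid setoid

    ×-con : ∀ m (p : Poly F X) w → m ×′ (p * con w) ≈ p * con (m ×″ w)
    ×-con zero    p w = sym (zeroʳ p)
    ×-con (suc m) p w = begin
      p * con w + m ×′ (p * con w)      ≈⟨ +-congˡ (×-con m p w) ⟩
      p * con w + p * con (m ×″ w)      ≈⟨ distribˡ _ _ _ ⟨
      p * (con w + con (m ×″ w))        ≈⟨ *-congˡ (con-+ w (m ×″ w)) ⟨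
      p * con (suc m ×″ w)              ∎

    rescale : ∀ m (p : Poly F X) w → m ×″ w F.+ m ×″ w F.≈ F.1# →
              m ×′ (p * con w) + m ×′ (p * con w) ≈ p
    rescale m p w 2mw≈1 = begin
      m ×′ (p * con w) + m ×′ (p * con w)     ≈⟨ +-cong (×-con m p w) (×-con m p w) ⟩
      p * con (m ×″ w) + p * con (m ×″ w)     ≈⟨ distribˡ _ _ _ ⟨
      p * (con (m ×″ w) + con (m ×″ w))       ≈⟨ *-congˡ (con-+ _ _) ⟨
      p * con (m ×″ w F.+ m ×″ w)             ≈⟨ *-congˡ (con-cong 2mw≈1) ⟩
      p * con F.1#                            ≈⟨ *-identityʳ p ⟩
      p                                       ∎

    projection : Characteristic≢2 F → ∀ {p : Poly F X} {s} → SkewCircuitFor F p s → ∀ e →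
                 Scalar.Invertible (Scalar.odd# (e ℕ.+ suc s)) →
                 IsProjection F p (Family.poly cycleFamily (e ℕ.+ suc s))
    projection 2#0 {p} {s} D e inv = σ 3≤m M , (begin
      p
        ≈⟨ rescale m p w 2mw≈1 ⟨
      m ×′ (p * con w) + m ×′ (p * con w)
        ≈⟨ +-cong (×-congʳ m T≈) (×-congʳ m T≈) ⟨
      m ×′ T + m ×′ T
        ≈⟨ substitute-layered 3≤m M k (2 ℕ.* k) ≡.refl ≡.refl ⟨
      substitute F (σ 3≤m M) (homPoly F (cycle m) (complete (m ℕ.^ 2))) ∎)
      where
      open SkewCircuitFor D
      open WalkSums (polynomials X)
      k = e ℕ.+ suc s
      m = suc (2 ℕ.* k)
      -- The m ^ 2 vertices form m layers, and m ^ 2 unfolds to m * m ^ 1.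
      d = m ℕ.^ 1
      n = 2 ℕ.* e ℕ.+ (s ℕ.* 2 ℕ.+ 1)
      w = proj₁ (Scalar.double-inverse 2#0 m inv)
      2mw≈1 = proj₂ (Scalar.double-inverse 2#0 m inv)
      -- The closing matrix leaves 2k of the m factors for instructions: 2s for the gates, one to
      -- load the output, and the remaining 2e + 1 hold its value.
      xs = program skew output (suc (2 ℕ.* e))

      2k≡ : 2 ℕ.* k ≡ suc n
      2k≡ = arith e s
        where
        arith : ∀ e s → 2 ℕ.* (e ℕ.+ suc s) ≡ suc (2 ℕ.* e ℕ.+ (s ℕ.* 2 ℕ.+ 1))
        arith = solve-∀

      length≡ : length xs ≡ suc n
      length≡ = ≡.trans (length-program skew output (suc (2 ℕ.* e))) (arith e s)
        where
        arith : ∀ e s → s ℕ.* 2 ℕ.+ suc (suc (2 ℕ.* e)) ≡ suc (2 ℕ.* e ℕ.+ (s ℕ.* 2 ℕ.+ 1))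
        arith = solve-∀

      -- The program addresses only cells below 2(s + 1), so m vertices per layer are enough.
      wide : suc s ℕ.* 2 ℕ.≤ m
      wide = ℕ.m≤n⇒m≤1+n (ℕ.≤-trans (ℕ.≤-reflexive (ℕ.*-comm (suc s) 2))
        (ℕ.*-monoʳ-≤ 2 (ℕ.m≤n+m (suc s) e)))

      wide′ : suc s ℕ.* 2 ℕ.≤ d
      wide′ = ℕ.≤-trans wide (ℕ.≤-reflexive (≡.sym (ℕ.^-identityʳ m)))

      3≤m : 3 ℕ.≤ m
      3≤m = s≤s (ℕ.*-monoʳ-≤ 2 (ℕ.≤-trans (s≤s z≤n) (ℕ.m≤n+m (suc s) e)))

      M : ℕ → Fin d → Fin d → Atom F X
      M l i j = matrices w xs l (toℕ i) (toℕ j)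

      T : Poly F X
      T = trace (product (λ l i j → ⟦ M l i j ⟧ₐ) (2 ℕ.* k))

      T≈ : T ≈ p * con w
      T≈ = begin
        T
          ≡⟨ ≡.cong (λ n → trace (product (λ l i j → ⟦ M l i j ⟧ₐ) n)) 2k≡ ⟩
        trace (product (λ l i j → ⟦ M l i j ⟧ₐ) (suc n))
          ≈⟨ trace-matrices w xs (All.map (Fits-mono wide′) (fits-program skew output _))
               (ℕ.≤-trans (s≤s (s≤s z≤n)) wide′) n length≡ ⟩
        run xs (initial w) 1
          ≈⟨ run-program skew output (suc (2 ℕ.* e)) ⟩
        ⟦_⟧ᵒ F output (⟦_⟧ F circuit) * con w
          ≈⟨ *-congʳ computes ⟩
        p * con w ∎

  hardness : Characteristic≢2 F → ∀ f → VBP F f → IsPProjection F f cycleFamily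
  hardness 2#0 f V = t
    , bounded⇒polyBounded (bounded-≤ t≤ (bounded-+
        (bounded-const 2) (polyBounded⇒bounded V.size-bounded)))
    , λ n → projection 2#0 (V.circuits n) (proj₁ (choice n)) (proj₂ (proj₂ (choice n)))
    where
    module V = VBP V
    choice = λ n → Scalar.choose 2#0 (suc (V.size n))
    t = λ n → proj₁ (choice n) ℕ.+ suc (V.size n)
    t≤ : ∀ n → t n ℕ.≤ 2 ℕ.+ V.size n
    t≤ n = ℕ.+-monoˡ-≤ (suc (V.size n)) (proj₁ (proj₂ (choice n)))

open import Data.Nat.Base using (_*_; _^_)

theorem6 : {c ℓ₁ ℓ₂ : Level} (F : HeytingField c ℓ₁ ℓ₂) →
    Characteristic≢2 F →
    VBPComplete F (homFamily F (λ k → cycle (suc (2 * k))) (λ k → complete (suc (2 * k) ^ 2)))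
theorem6 F 2#0 = Completeness.membership F , Completeness.hardness F 2#0
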